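{- Let $\delta$ be a positive integer that is not a perfect square. Then there exists an integer $s\ge1$ such that for every integer $n\ge0$, $$[\overline{2,1,1,1,(s,1,1,2,1,1)^n,s,1,2,1,1,1,1,s,(1,1,2,1,1,s)^n}]\in\mathbb{Q}[\sqrt{\delta}].$$
   Context: $[\overline{u_1,\dots,u_p}]$ denotes the real number whose continued fraction expansion is purely periodic with period $(u_1,\dots,u_p)$. The notation $(u_1,\dots,u_k)^n$ means that the pattern $u_1,\dots,u_k$ is repeated $n$ times. -}

module Defs where

open import Data.Integer.Base using (+_)
open import Data.List.Base using (List; []; _∷_; _++_; concat; replicate; length; lookup)
open import Data.Nat.Base as ℕ using (ℕ; suc; NonZero)
open import Data.Nat.DivMod using (_mod_)
open import Data.Product.Base using (Σ; Σ-syntax; _×_)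
open import Data.Rational.Base as ℚ using (ℚ; 0ℚ)
open import Relation.Binary.PropositionalEquality.Core using (_≡_; _≢_)

-- The subset ℚ[√δ] = { re + im √δ : re, im ∈ ℚ } of ℝ, where √δ is the
-- positive square root.  It is only used for δ not a perfect square; then
-- 1 and √δ are linearly independent over ℚ, so that propositional
-- equality of records is equality of real numbers.
record ℚ[√_] (δ : ℕ) : Set where
  constructor _+_√
  field
    re : ℚ
    im : ℚ

fromℕ : ∀ {δ} → ℕ → ℚ[√ δ ]
fromℕ n = (+ n ℚ./ 1) + 0ℚ √

infixl 6 _-_
infixl 7 _*_

_-_ : ∀ {δ} → ℚ[√ δ ] → ℚ[√ δ ] → ℚ[√ δ ]
(a + b √) - (c + d √) = (a ℚ.- c) + (b ℚ.- d) √

_*_ : ∀ {δ} → ℚ[√ δ ] → ℚ[√ δ ] → ℚ[√ δ ]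
_*_ {δ} (a + b √) (c + d √) =
  (a ℚ.* c ℚ.+ (+ δ ℚ./ 1) ℚ.* (b ℚ.* d)) + (a ℚ.* d ℚ.+ b ℚ.* c) √

-- 0 ≤ a + b √δ as a real number.  When a and b have opposite signs, the
-- sign of a + b √δ is decided by comparing a² with δ b².
data NonNegative {δ : ℕ} : ℚ[√ δ ] → Set where
  both : ∀ {a b} → 0ℚ ℚ.≤ a → 0ℚ ℚ.≤ b → NonNegative (a + b √)
  im≤0 : ∀ {a b} → 0ℚ ℚ.≤ a → b ℚ.≤ 0ℚ →
         (+ δ ℚ./ 1) ℚ.* (b ℚ.* b) ℚ.≤ a ℚ.* a → NonNegative (a + b √)
  re≤0 : ∀ {a b} → a ℚ.≤ 0ℚ → 0ℚ ℚ.≤ b →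
         a ℚ.* a ℚ.≤ (+ δ ℚ./ 1) ℚ.* (b ℚ.* b) → NonNegative (a + b √)

infix 4 _≤_ _<_

_≤_ : ∀ {δ} → ℚ[√ δ ] → ℚ[√ δ ] → Set
x ≤ y = NonNegative (y - x)

_<_ : ∀ {δ} → ℚ[√ δ ] → ℚ[√ δ ] → Set
x < y = x ≤ y × x ≢ y

-- The infinite continued fraction expansion of x is u₀, u₁, u₂, … :
-- the complete quotients are ξ₀ = x and ξᵢ₊₁ = 1 / (ξᵢ - ⌊ξᵢ⌋), and
-- uᵢ = ⌊ξᵢ⌋.  If x ∈ ℚ[√δ], all its complete quotients are in ℚ[√δ] too.
record _HasExpansion_ {δ : ℕ} (x : ℚ[√ δ ]) (u : ℕ → ℕ) : Set where
  field
    ξ       : ℕ → ℚ[√ δ ]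
    ξ-zero  : ξ 0 ≡ x
    floor-≤ : ∀ i → fromℕ (u i) ≤ ξ i
    floor-> : ∀ i → ξ i < fromℕ (suc (u i))
    ξ-suc   : ∀ i → (ξ i - fromℕ (u i)) * ξ (suc i) ≡ fromℕ 1

cycle : (w : List ℕ) .{{_ : NonZero (length w)}} → ℕ → ℕ
cycle w i = lookup w (i mod length w)

-- The real number whose continued fraction expansion is purely periodic
-- with period w belongs to ℚ[√δ].  A real number is determined by its
-- expansion, so this says that some element of ℚ[√δ] has that expansion.
[overline_]∈ℚ[√_] : (w : List ℕ) (δ : ℕ) .{{_ : NonZero (length w)}} → Set
[overline w ]∈ℚ[√ δ ] = Σ[ x ∈ ℚ[√ δ ] ] x HasExpansion cycle w

infixr 8 _^^_

_^^_ : List ℕ → ℕ → List ℕ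
w ^^ n = concat (replicate n w)

period : ℕ → ℕ → List ℕ
period s n =
  (2 ∷ 1 ∷ 1 ∷ 1 ∷ []) ++
  (s ∷ 1 ∷ 1 ∷ 2 ∷ 1 ∷ 1 ∷ []) ^^ n ++
  (s ∷ 1 ∷ 2 ∷ 1 ∷ 1 ∷ 1 ∷ 1 ∷ s ∷ []) ++
  (1 ∷ 1 ∷ 2 ∷ 1 ∷ 1 ∷ s ∷ []) ^^ n

{-# OPTIONS --safe #-}

-- A purely periodic expansion with matrix M = ∏ (uᵢ 1; 1 0) of determinant 1
-- represents an element of ℚ[√δ] as soon as (tr M)² - 4 is δ times a nonzero
-- square.  Let B be the matrix of s,1,1,2,1,1; it has trace 2 x, x = 6 s + 7, and
-- determinant 1, and the reversed block has the transposed matrix.  For the period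
-- in question (tr M)² - 4 = 16 T² (T² - 1), where 2 T is the trace of Bⁿ⁺¹, and
-- T² - 1 = (x² - 1) ρ² for an integer ρ.  So it suffices that x² - 1 = δ y², i.e. that
-- Pell's equation has a solution with x ≡ 1 modulo 6, x > 7; the fourth power of
-- any nontrivial solution is one.
--
-- Pell's equation is solved by reduction of forms: the finitely many forms
-- a x² + 2 b x y - c y² with a, c > 0 and b² + a c = δ are permuted by replacing one
-- basis vector by the sum of both, whichever keeps a, c > 0, so that x² - δ y² is
-- reached again, and the change of basis is a nontrivial automorph.
module Submission where

open import Defs using ([overline_]∈ℚ[√_]; period)
open import Data.Nat.Base using (ℕ; _*_; _≤_)
open import Data.Product.Base using (∃-syntax; _×_)
open import Relation.Binary.PropositionalEquality.Core using (_≡_)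
open import Relation.Nullary.Negation.Core using (¬_)

open import Data.Fin.Base using (Fin; zero; suc; toℕ; fromℕ<; combine)
import Data.Fin.Properties as Fin
open import Data.Integer.Base as ℤ using (ℤ; +_; -[1+_]; ∣_∣; sign; _◃_)
import Data.Integer.Properties as ℤ
import Data.Integer.Tactic.RingSolver as ℤ-Solver
open import Data.List.Base using (List; []; _∷_; _++_; length; lookup)
open import Data.List.Membership.Propositional.Properties using (∈-lookup)
open import Data.List.Relation.Unary.All as All using (All; []; _∷_)
import Data.List.Relation.Unary.All.Properties as All
open import Data.Nat.Base as ℕ using (zero; suc; _+_; _<_; s≤s; z≤n; NonZero)
open import Data.Nat.DivMod using (_mod_; m<n⇒m%n≡m; [m+n]%n≡m%n)
open import Data.Nat.GeneralisedArithmetic using (fold)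
import Data.Nat.Properties as ℕ
import Data.Nat.Tactic.RingSolver as ℕ-Solver
open import Data.Product.Base using (_,_; proj₁; proj₂)
open import Data.Rational.Base as ℚ using (ℚ; 0ℚ; 1ℚ)
import Data.Rational.Properties as ℚ
open import Data.Rational.Unnormalised.Base as ℚᵘ using (mkℚᵘ; *≡*)
import Data.Rational.Unnormalised.Properties as ℚᵘ
open import Data.Sign.Base using (Sign)
open import Defs using (ℚ[√_]; _+_√; fromℕ; NonNegative; im≤0; re≤0; _HasExpansion_; _^^_; cycle)
import Defs
open import Relation.Binary.PropositionalEquality using (_≢_; refl; sym; trans; cong; cong₂; subst; subst₂; module ≡-Reasoning)
open import Relation.Nullary.Decidable.Core using (dec⇒maybe)
open import Relation.Nullary.Negation.Core using (contradiction)
open import Tactic.RingSolver using (solve-∀)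
open import Tactic.RingSolver.Core.AlmostCommutativeRing using (AlmostCommutativeRing; fromCommutativeRing)

i*i≡∣i∣*∣i∣ : ∀ i → i ℤ.* i ≡ + (∣ i ∣ * ∣ i ∣)
i*i≡∣i∣*∣i∣ (+ n)    = sym (ℤ.pos-* n n)
i*i≡∣i∣*∣i∣ -[1+ n ] = refl

-- Pell's equation

-- The quadratic form a x² + 2 b x y - c y² with a = suc a₋ and c = suc c₋.
record Form : Set where
  constructor form
  field
    a₋ : ℕ
    b  : ℤ
    c₋ : ℕ

disc : Form → ℤ
disc (form a b c) = b ℤ.* b ℤ.+ + suc a ℤ.* + suc c

-- The value of the form at (1, 1), respectively at (1, -1).
mediant antimediant : Form → ℤ
mediant     (form a b c) = + suc a ℤ.+ (b ℤ.+ b) ℤ.- + suc c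
antimediant (form a b c) = + suc a ℤ.- (b ℤ.+ b) ℤ.- + suc c

-- The argument is the value at the sum of the basis vectors. That value becomes the new first
-- coefficient if positive and the new last one if negative, so the positivity of `a` and `c`
-- persists. The clause for zero is a default value; it never occurs when the discriminant is not a
-- square.
refine : ℤ → Form → Form
refine (+ zero)    f            = f
refine (+ suc m)   (form a b c) = form m (b ℤ.- + suc c) c
refine (-[1+ m ])  (form a b c) = form a (+ suc a ℤ.+ b) m

restore : ℤ → Form → Form
restore (+ zero)    f            = f
restore (+ suc m)   (form a b c) = form m (b ℤ.+ + suc c) c
restore (-[1+ m ])  (form a b c) = form a (b ℤ.- + suc a) m

step back : Form → Form
step f = refine (mediant f) f
back f = restore (antimediant f) f

-- In the new basis, (1, -1) is the discarded basis vector up to sign. So the sign of `antimediant`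
-- tells which vector was replaced, and its value gives back the lost coefficient.
back-step : ∀ f → mediant f ≢ ℤ.0ℤ → back (step f) ≡ f
back-step f@(form a b c) m≢0 with mediant f in eq
... | + zero   = contradiction refl m≢0
... | + suc m  = begin
  restore (antimediant (form m (b ℤ.- + suc c) c)) (form m (b ℤ.- + suc c) c)
    ≡⟨ cong (λ v → restore v (form m (b ℤ.- + suc c) c)) a≡ ⟩
  form a (b ℤ.- + suc c ℤ.+ + suc c) c
    ≡⟨ cong (λ b → form a b c) (cancel b (+ suc c)) ⟩
  form a b c ∎
  where
  open ≡-Reasoning
  cancel : ∀ b c → b ℤ.- c ℤ.+ c ≡ b
  cancel = ℤ-Solver.solve-∀
  new-antimediant : ∀ a b c → a ℤ.+ (b ℤ.+ b) ℤ.- c ℤ.- (b ℤ.- c ℤ.+ (b ℤ.- c)) ℤ.- c ≡ a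
  new-antimediant = ℤ-Solver.solve-∀
  a≡ : antimediant (form m (b ℤ.- + suc c) c) ≡ + suc a
  a≡ = trans (cong (λ v → v ℤ.- (b ℤ.- + suc c ℤ.+ (b ℤ.- + suc c)) ℤ.- + suc c) (sym eq))
             (new-antimediant (+ suc a) b (+ suc c))
... | -[1+ m ] = begin
  restore (antimediant (form a (+ suc a ℤ.+ b) m)) (form a (+ suc a ℤ.+ b) m)
    ≡⟨ cong (λ v → restore v (form a (+ suc a ℤ.+ b) m)) -c≡ ⟩
  form a (+ suc a ℤ.+ b ℤ.- + suc a) c
    ≡⟨ cong (λ b → form a b c) (cancel b (+ suc a)) ⟩
  form a b c ∎
  where
  open ≡-Reasoning
  cancel : ∀ b a → a ℤ.+ b ℤ.- a ≡ b
  cancel = ℤ-Solver.solve-∀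
  new-antimediant : ∀ a b c → a ℤ.- (a ℤ.+ b ℤ.+ (a ℤ.+ b)) ℤ.+ (a ℤ.+ (b ℤ.+ b) ℤ.- c) ≡ ℤ.- c
  new-antimediant = ℤ-Solver.solve-∀
  -c≡ : antimediant (form a (+ suc a ℤ.+ b) m) ≡ -[1+ c ]
  -c≡ = trans (cong (λ v → + suc a ℤ.- (+ suc a ℤ.+ b ℤ.+ (+ suc a ℤ.+ b)) ℤ.+ v) (sym eq))
              (new-antimediant (+ suc a) b (+ suc c))

disc-step : ∀ f → disc (step f) ≡ disc f
disc-step f@(form a b c) with mediant f in eq
... | + zero   = refl
... | + suc m  = trans
  (cong (λ v → (b ℤ.- + suc c) ℤ.* (b ℤ.- + suc c) ℤ.+ v ℤ.* + suc c) (sym eq))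
  (invariance (+ suc a) b (+ suc c))
  where
  invariance : ∀ a b c → (b ℤ.- c) ℤ.* (b ℤ.- c) ℤ.+ (a ℤ.+ (b ℤ.+ b) ℤ.- c) ℤ.* c ≡ b ℤ.* b ℤ.+ a ℤ.* c
  invariance = ℤ-Solver.solve-∀
... | -[1+ m ] = trans
  (cong (λ v → (+ suc a ℤ.+ b) ℤ.* (+ suc a ℤ.+ b) ℤ.+ + suc a ℤ.* ℤ.- v) (sym eq))
  (invariance (+ suc a) b (+ suc c))
  where
  invariance : ∀ a b c → (a ℤ.+ b) ℤ.* (a ℤ.+ b) ℤ.+ a ℤ.* ℤ.- (a ℤ.+ (b ℤ.+ b) ℤ.- c) ≡ b ℤ.* b ℤ.+ a ℤ.* c
  invariance = ℤ-Solver.solve-∀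

-- The discriminant b² + a c equals (a + b)² - a (a + 2 b - c), and the last factor is the mediant.
mediant≡0⇒disc-square : ∀ f → mediant f ≡ ℤ.0ℤ → ∃[ k ] disc f ≡ + (k * k)
mediant≡0⇒disc-square f@(form a b c) eq = ∣ + suc a ℤ.+ b ∣ , (begin
  b ℤ.* b ℤ.+ + suc a ℤ.* + suc c
    ≡⟨ complete-square (+ suc a) b (+ suc c) ⟩
  (+ suc a ℤ.+ b) ℤ.* (+ suc a ℤ.+ b) ℤ.- + suc a ℤ.* mediant f
    ≡⟨ cong (λ v → (+ suc a ℤ.+ b) ℤ.* (+ suc a ℤ.+ b) ℤ.- + suc a ℤ.* v) eq ⟩
  (+ suc a ℤ.+ b) ℤ.* (+ suc a ℤ.+ b) ℤ.- + suc a ℤ.* ℤ.0ℤ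
    ≡⟨ drop-zero (+ suc a) (+ suc a ℤ.+ b) ⟩
  (+ suc a ℤ.+ b) ℤ.* (+ suc a ℤ.+ b)
    ≡⟨ i*i≡∣i∣*∣i∣ (+ suc a ℤ.+ b) ⟩
  + (∣ + suc a ℤ.+ b ∣ * ∣ + suc a ℤ.+ b ∣) ∎)
  where
  open ≡-Reasoning
  complete-square : ∀ a b c → b ℤ.* b ℤ.+ a ℤ.* c ≡ (a ℤ.+ b) ℤ.* (a ℤ.+ b) ℤ.- a ℤ.* (a ℤ.+ (b ℤ.+ b) ℤ.- c)
  complete-square = ℤ-Solver.solve-∀
  drop-zero : ∀ a b → b ℤ.* b ℤ.- a ℤ.* ℤ.0ℤ ≡ b ℤ.* b
  drop-zero = ℤ-Solver.solve-∀

-- The form is x² - δ y² in the coordinates with basis vectors (p, r) and (q, t).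
record Represents (δ : ℕ) (f : Form) (p q r t : ℕ) : Set where
  open Form f
  field
    a≡  : + p ℤ.* + p ℤ.- + δ ℤ.* (+ r ℤ.* + r) ≡ + suc a₋
    b≡  : + p ℤ.* + q ℤ.- + δ ℤ.* (+ r ℤ.* + t) ≡ b
    c≡  : + q ℤ.* + q ℤ.- + δ ℤ.* (+ t ℤ.* + t) ≡ -[1+ c₋ ]
    1≤p : 1 ≤ p
    1≤t : 1 ≤ t

-- One basis vector is added to the other, and all coordinates are natural numbers. Hence `1≤t` or
-- `1≤p` makes an off-diagonal entry positive; `1 ≤ q′ + r′` records that the basis is not the
-- standard one.
represents-step : ∀ {δ f p q r t} → Represents δ f p q r t → mediant f ≢ ℤ.0ℤ →
  ∃[ p′ ] ∃[ q′ ] ∃[ r′ ] ∃[ t′ ] (Represents δ (step f) p′ q′ r′ t′ × 1 ≤ q′ + r′)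
represents-step {δ} {f@(form a b c)} {p} {q} {r} {t} rep m≢0 with mediant f in eq
... | + zero   = contradiction refl m≢0
... | + suc m  = p + q , q , r + t , t , record
  { a≡  = trans (diagonal (+ p) (+ q) (+ r) (+ t) (+ δ)) (trans values eq)
  ; b≡  = trans (offdiagonal (+ p) (+ q) (+ r) (+ t) (+ δ)) (cong₂ ℤ._+_ b≡ c≡)
  ; c≡  = c≡
  ; 1≤p = ℕ.≤-trans 1≤p (ℕ.m≤m+n p q)
  ; 1≤t = 1≤t
  } , ℕ.≤-trans 1≤t (ℕ.≤-trans (ℕ.m≤n+m t r) (ℕ.m≤n+m (r + t) q))
  where
  open Represents rep
  diagonal : ∀ p q r t δ → (p ℤ.+ q) ℤ.* (p ℤ.+ q) ℤ.- δ ℤ.* ((r ℤ.+ t) ℤ.* (r ℤ.+ t)) ≡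
    p ℤ.* p ℤ.- δ ℤ.* (r ℤ.* r) ℤ.+ (p ℤ.* q ℤ.- δ ℤ.* (r ℤ.* t) ℤ.+ (p ℤ.* q ℤ.- δ ℤ.* (r ℤ.* t)))
      ℤ.+ (q ℤ.* q ℤ.- δ ℤ.* (t ℤ.* t))
  diagonal = ℤ-Solver.solve-∀
  offdiagonal : ∀ p q r t δ → (p ℤ.+ q) ℤ.* q ℤ.- δ ℤ.* ((r ℤ.+ t) ℤ.* t) ≡
    p ℤ.* q ℤ.- δ ℤ.* (r ℤ.* t) ℤ.+ (q ℤ.* q ℤ.- δ ℤ.* (t ℤ.* t))
  offdiagonal = ℤ-Solver.solve-∀
  values = cong₂ ℤ._+_ (cong₂ ℤ._+_ a≡ (cong₂ ℤ._+_ b≡ b≡)) c≡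
... | -[1+ m ] = p , p + q , r , r + t , record
  { a≡  = a≡
  ; b≡  = trans (offdiagonal (+ p) (+ q) (+ r) (+ t) (+ δ)) (cong₂ ℤ._+_ a≡ b≡)
  ; c≡  = trans (diagonal (+ p) (+ q) (+ r) (+ t) (+ δ)) (trans values eq)
  ; 1≤p = 1≤p
  ; 1≤t = ℕ.≤-trans 1≤t (ℕ.m≤n+m t r)
  } , ℕ.≤-trans 1≤p (ℕ.≤-trans (ℕ.m≤m+n p q) (ℕ.m≤m+n (p + q) r))
  where
  open Represents rep
  diagonal : ∀ p q r t δ → (p ℤ.+ q) ℤ.* (p ℤ.+ q) ℤ.- δ ℤ.* ((r ℤ.+ t) ℤ.* (r ℤ.+ t)) ≡
    p ℤ.* p ℤ.- δ ℤ.* (r ℤ.* r) ℤ.+ (p ℤ.* q ℤ.- δ ℤ.* (r ℤ.* t) ℤ.+ (p ℤ.* q ℤ.- δ ℤ.* (r ℤ.* t)))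
      ℤ.+ (q ℤ.* q ℤ.- δ ℤ.* (t ℤ.* t))
  diagonal = ℤ-Solver.solve-∀
  offdiagonal : ∀ p q r t δ → p ℤ.* (p ℤ.+ q) ℤ.- δ ℤ.* (r ℤ.* (r ℤ.+ t)) ≡
    p ℤ.* p ℤ.- δ ℤ.* (r ℤ.* r) ℤ.+ (p ℤ.* q ℤ.- δ ℤ.* (r ℤ.* t))
  offdiagonal = ℤ-Solver.solve-∀
  values = cong₂ ℤ._+_ (cong₂ ℤ._+_ a≡ (cong₂ ℤ._+_ b≡ b≡)) c≡

-- The coefficient a = 1 is Pell's equation for (p, r). If r were 0, then b = 0 would give p q = δ r
-- t = 0, although p and q would both be positive.
represents-principal : ∀ {δ c p q r t} → Represents δ (form 0 ℤ.0ℤ c) p q r t → 1 ≤ q + r →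
  1 ≤ r × p * p ≡ δ * (r * r) + 1
represents-principal {δ} {c} {p} {q} {r} {t} rep 1≤q+r = 1≤r r 1≤q+r b≡′ , pell
  where
  open Represents rep
  add-subtract : ∀ x y → x ≡ y ℤ.+ (x ℤ.- y)
  add-subtract = ℤ-Solver.solve-∀
  pos-** : ∀ k m n → + k ℤ.* (+ m ℤ.* + n) ≡ + (k * (m * n))
  pos-** k m n = trans (cong (+ k ℤ.*_) (sym (ℤ.pos-* m n))) (sym (ℤ.pos-* k (m * n)))
  pell : p * p ≡ δ * (r * r) + 1
  pell = ℤ.+-injective (trans (ℤ.pos-* p p) (trans (add-subtract _ (+ δ ℤ.* (+ r ℤ.* + r)))
    (cong₂ ℤ._+_ (pos-** δ r r) a≡)))
  b≡′ : p * q ≡ δ * (r * t) + 0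
  b≡′ = ℤ.+-injective (trans (ℤ.pos-* p q) (trans (add-subtract _ (+ δ ℤ.* (+ r ℤ.* + t)))
    (cong₂ ℤ._+_ (pos-** δ r t) b≡)))
  1≤r : ∀ r → 1 ≤ q + r → p * q ≡ δ * (r * t) + 0 → 1 ≤ r
  1≤r (suc r) _     _  = s≤s z≤n
  1≤r zero    1≤q+0 pq = contradiction (trans pq (cong (_+ 0) (ℕ.*-zeroʳ δ)))
    (ℕ.>⇒≢ (ℕ.*-mono-≤ 1≤p (subst (1 ≤_) (ℕ.+-identityʳ q) 1≤q+0)))

-- Finiteness of the set of forms of given discriminant

fromSign : Sign → Fin 2
fromSign Sign.+ = zero
fromSign Sign.- = suc zero

fromSign-injective : ∀ s s′ → fromSign s ≡ fromSign s′ → s ≡ s′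
fromSign-injective Sign.+ Sign.+ _ = refl
fromSign-injective Sign.- Sign.- _ = refl

repetition : ∀ {N} (f : ℕ → Fin N) → ∃[ i ] ∃[ k ] f i ≡ f (i + suc k)
repetition {N} f
  with i , j , i<j , eq ← Fin.pigeonhole (ℕ.n<1+n N) (λ i → f (toℕ i))
  with k , j≡ ← ℕ.m≤n⇒∃[o]m+o≡n i<j
  = toℕ i , k , trans eq (cong f (sym (trans (ℕ.+-suc (toℕ i) k) j≡)))

module _ {δ : ℕ} where

  -- Both summands of b² + a c = δ are natural numbers, so `a`, `c` and the absolute value of `b`
  -- are at most δ.
  disc-ℕ : ∀ f → disc f ≡ + δ → let open Form f in ∣ b ∣ * ∣ b ∣ + suc a₋ * suc c₋ ≡ δ
  disc-ℕ (form a b c) eq = ℤ.+-injective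
    (trans (cong₂ ℤ._+_ (sym (i*i≡∣i∣*∣i∣ b)) (ℤ.pos-* (suc a) (suc c))) eq)

  a₋< : ∀ f → disc f ≡ + δ → Form.a₋ f < suc δ
  a₋< f@(form a b c) eq = ℕ.m≤n⇒m≤1+n (subst (suc a ≤_) (disc-ℕ f eq)
    (ℕ.≤-trans (ℕ.m≤m*n (suc a) (suc c)) (ℕ.m≤n+m _ (∣ b ∣ * ∣ b ∣))))

  c₋< : ∀ f → disc f ≡ + δ → Form.c₋ f < suc δ
  c₋< f@(form a b c) eq = ℕ.m≤n⇒m≤1+n (subst (suc c ≤_) (disc-ℕ f eq)
    (ℕ.≤-trans (ℕ.m≤n*m (suc c) (suc a)) (ℕ.m≤n+m _ (∣ b ∣ * ∣ b ∣))))

  ∣b∣< : ∀ f → disc f ≡ + δ → ∣ Form.b f ∣ < suc δ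
  ∣b∣< f@(form a b c) eq = s≤s (subst (∣ b ∣ ≤_) (disc-ℕ f eq)
    (ℕ.≤-trans (m≤m² ∣ b ∣) (ℕ.m≤m+n _ (suc a * suc c))))
    where
    m≤m² : ∀ m → m ≤ m * m
    m≤m² zero    = z≤n
    m≤m² (suc m) = ℕ.m≤m*n (suc m) (suc m)

  code : ∀ f → disc f ≡ + δ → Fin (suc δ * (suc δ * (suc δ * 2)))
  code f eq = combine (fromℕ< (a₋< f eq)) (combine (fromℕ< (c₋< f eq))
    (combine (fromℕ< (∣b∣< f eq)) (fromSign (sign (Form.b f)))))

  code-injective : ∀ f g f≡ g≡ → code f f≡ ≡ code g g≡ → f ≡ g
  code-injective f@(form a b c) g@(form a′ b′ c′) f≡ g≡ eq
    with a≡ , eq₁ ← Fin.combine-injective (fromℕ< (a₋< f f≡)) _ (fromℕ< (a₋< g g≡)) _ eq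
    with c≡ , eq₂ ← Fin.combine-injective (fromℕ< (c₋< f f≡)) _ (fromℕ< (c₋< g g≡)) _ eq₁
    with b≡ , s≡ ← Fin.combine-injective (fromℕ< (∣b∣< f f≡)) _ (fromℕ< (∣b∣< g g≡)) _ eq₂
    with refl ← Fin.fromℕ<-injective _ _ (a₋< f f≡) (a₋< g g≡) a≡
       | refl ← Fin.fromℕ<-injective _ _ (c₋< f f≡) (c₋< g g≡) c≡
    = cong (λ b → form a b c) (trans (sym (ℤ.signᵢ◃∣i∣≡i b)) (trans
        (cong₂ _◃_ (fromSign-injective (sign b) (sign b′) s≡)
                   (Fin.fromℕ<-injective _ _ (∣b∣< f f≡) (∣b∣< g g≡) b≡))
        (ℤ.signᵢ◃∣i∣≡i b′)))

-- The cycle of the principal form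

module _ (d : ℕ) (nonsquare : ¬ (∃[ k ] suc d ≡ k * k)) where

  -- The start is the principal form x² - δ y² with δ = `suc d`.
  orbit : ℕ → Form
  orbit = fold (form 0 ℤ.0ℤ d) step

  disc-orbit : ∀ n → disc (orbit n) ≡ + suc d
  disc-orbit zero    = cong (λ n → + suc n) (ℕ.+-identityʳ d)
  disc-orbit (suc n) = trans (disc-step (orbit n)) (disc-orbit n)

  mediant-orbit≢0 : ∀ n → mediant (orbit n) ≢ ℤ.0ℤ
  mediant-orbit≢0 n eq =
    let k , disc≡ = mediant≡0⇒disc-square (orbit n) eq
    in nonsquare (k , ℤ.+-injective (trans (sym (disc-orbit n)) disc≡))

  back-orbit : ∀ n → back (orbit (suc n)) ≡ orbit n
  back-orbit n = back-step (orbit n) (mediant-orbit≢0 n)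

  -- As `back` undoes `step` along the orbit, a repetition can be moved down to the start: the orbit
  -- is purely periodic.
  orbit-cancel : ∀ i k → orbit i ≡ orbit (i + k) → orbit 0 ≡ orbit k
  orbit-cancel zero    k eq = eq
  orbit-cancel (suc i) k eq = orbit-cancel i k
    (trans (sym (back-orbit i)) (trans (cong back eq) (back-orbit (i + k))))

  orbit-returns : ∃[ k ] orbit (suc k) ≡ orbit 0
  orbit-returns = k , sym (orbit-cancel i (suc k)
    (code-injective _ _ (disc-orbit i) (disc-orbit (i + suc k)) eq))
    where
    repeated = repetition (λ n → code (orbit n) (disc-orbit n))
    i  = proj₁ repeated
    k  = proj₁ (proj₂ repeated)
    eq = proj₂ (proj₂ repeated)

  -- The index is `suc n` because the standard basis, which belongs to `orbit 0`, has q + r = 0.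
  orbit-represents : ∀ n → ∃[ p ] ∃[ q ] ∃[ r ] ∃[ t ]
    (Represents (suc d) (orbit (suc n)) p q r t × 1 ≤ q + r)
  orbit-represents zero    = represents-step {p = 1} {0} {0} {1} (record
    { a≡  = cong (λ i → ℤ.1ℤ ℤ.- i) (ℤ.*-zeroʳ (+ suc d))
    ; b≡  = cong (λ i → ℤ.0ℤ ℤ.- i) (ℤ.*-zeroʳ (+ suc d))
    ; c≡  = cong -[1+_] (ℕ.*-identityʳ d)
    ; 1≤p = s≤s z≤n
    ; 1≤t = s≤s z≤n
    }) (mediant-orbit≢0 0)
  orbit-represents (suc n) with _ , _ , _ , _ , rep , _ ← orbit-represents n =
    represents-step rep (mediant-orbit≢0 (suc n))

  pell-solvable : ∃[ x ] ∃[ y ] (1 ≤ y × x * x ≡ suc d * (y * y) + 1)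
  pell-solvable = solution orbit-returns
    where
    solution : ∃[ k ] orbit (suc k) ≡ orbit 0 → ∃[ x ] ∃[ y ] (1 ≤ y × x * x ≡ suc d * (y * y) + 1)
    solution (k , returns) with p , q , r , t , rep , 1≤q+r ← orbit-represents k =
      p , r , represents-principal (subst (λ f → Represents (suc d) f p q r t) returns rep) 1≤q+r

-- Expansions of quadratic irrationals

ℚ-ring : AlmostCommutativeRing _ _
ℚ-ring = fromCommutativeRing ℚ.+-*-commutativeRing (λ x → dec⇒maybe (0ℚ ℚ.≟ x))

ι : ℕ → ℚ
ι n = + n ℚ./ 1

fromℚᵘ-homo-+ : ∀ p q → ℚ.fromℚᵘ (p ℚᵘ.+ q) ≡ ℚ.fromℚᵘ p ℚ.+ ℚ.fromℚᵘ q
fromℚᵘ-homo-+ p q = ℚ.toℚᵘ-injective (begin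
  ℚ.toℚᵘ (ℚ.fromℚᵘ (p ℚᵘ.+ q))
    ≈⟨ ℚ.toℚᵘ-fromℚᵘ (p ℚᵘ.+ q) ⟩
  p ℚᵘ.+ q
    ≈⟨ ℚᵘ.+-cong (ℚ.toℚᵘ-fromℚᵘ p) (ℚ.toℚᵘ-fromℚᵘ q) ⟨
  ℚ.toℚᵘ (ℚ.fromℚᵘ p) ℚᵘ.+ ℚ.toℚᵘ (ℚ.fromℚᵘ q)
    ≈⟨ ℚ.toℚᵘ-homo-+ (ℚ.fromℚᵘ p) (ℚ.fromℚᵘ q) ⟨
  ℚ.toℚᵘ (ℚ.fromℚᵘ p ℚ.+ ℚ.fromℚᵘ q) ∎)
  where open import Relation.Binary.Reasoning.Setoid ℚᵘ.≃-setoid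

fromℚᵘ-homo-* : ∀ p q → ℚ.fromℚᵘ (p ℚᵘ.* q) ≡ ℚ.fromℚᵘ p ℚ.* ℚ.fromℚᵘ q
fromℚᵘ-homo-* p q = ℚ.toℚᵘ-injective (begin
  ℚ.toℚᵘ (ℚ.fromℚᵘ (p ℚᵘ.* q))
    ≈⟨ ℚ.toℚᵘ-fromℚᵘ (p ℚᵘ.* q) ⟩
  p ℚᵘ.* q
    ≈⟨ ℚᵘ.*-cong (ℚ.toℚᵘ-fromℚᵘ p) (ℚ.toℚᵘ-fromℚᵘ q) ⟨
  ℚ.toℚᵘ (ℚ.fromℚᵘ p) ℚᵘ.* ℚ.toℚᵘ (ℚ.fromℚᵘ q)
    ≈⟨ ℚ.toℚᵘ-homo-* (ℚ.fromℚᵘ p) (ℚ.fromℚᵘ q) ⟨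
  ℚ.toℚᵘ (ℚ.fromℚᵘ p ℚ.* ℚ.fromℚᵘ q) ∎)
  where open import Relation.Binary.Reasoning.Setoid ℚᵘ.≃-setoid

ι-+ : ∀ m n → ι (m + n) ≡ ι m ℚ.+ ι n
ι-+ m n = trans
  (ℚ.fromℚᵘ-cong {mkℚᵘ (+ (m + n)) 0} {mkℚᵘ (+ m) 0 ℚᵘ.+ mkℚᵘ (+ n) 0} (*≡* (cong (ℤ._* ℤ.1ℤ)
    (sym (cong₂ ℤ._+_ (ℤ.*-identityʳ (+ m)) (ℤ.*-identityʳ (+ n)))))))
  (fromℚᵘ-homo-+ (mkℚᵘ (+ m) 0) (mkℚᵘ (+ n) 0))

ι-* : ∀ m n → ι (m * n) ≡ ι m ℚ.* ι n
ι-* m n = trans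
  (ℚ.fromℚᵘ-cong {mkℚᵘ (+ (m * n)) 0} {mkℚᵘ (+ m) 0 ℚᵘ.* mkℚᵘ (+ n) 0}
    (*≡* (cong (ℤ._* ℤ.1ℤ) (ℤ.pos-* m n))))
  (fromℚᵘ-homo-* (mkℚᵘ (+ m) 0) (mkℚᵘ (+ n) 0))

ι-injective : ∀ {m n} → ι m ≡ ι n → m ≡ n
ι-injective {m} {n} eq with *≡* m≡n ← ℚ.fromℚᵘ-injective {mkℚᵘ (+ m) 0} {mkℚᵘ (+ n) 0} eq =
  ℤ.+-injective (ℤ.*-cancelʳ-≡ (+ m) (+ n) ℤ.1ℤ m≡n)

0≤ι : ∀ n → 0ℚ ℚ.≤ ι n
0≤ι n = ℚ.nonNegative⁻¹ (ι n) {{ℚ.normalize-nonNeg n 1}}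

1/suc : ℕ → ℚ
1/suc n = + 1 ℚ./ suc n

0≤1/suc : ∀ n → 0ℚ ℚ.≤ 1/suc n
0≤1/suc n = ℚ.nonNegative⁻¹ (1/suc n) {{ℚ.normalize-nonNeg 1 (suc n)}}

ι*1/suc : ∀ n → ι (suc n) ℚ.* 1/suc n ≡ 1ℚ
ι*1/suc n = trans (sym (fromℚᵘ-homo-* (mkℚᵘ (+ suc n) 0) (mkℚᵘ (+ 1) n)))
  (ℚ.fromℚᵘ-cong {mkℚᵘ (+ suc n) 0 ℚᵘ.* mkℚᵘ (+ 1) n} {ℚᵘ.1ℚᵘ}
    (*≡* (trans (ℤ.*-identityʳ (+ suc n ℤ.* ℤ.1ℤ)) (trans (ℤ.*-identityʳ (+ suc n))
      (sym (trans (ℤ.*-identityˡ _) (ℤ.*-identityˡ (+ suc n))))))))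

0≤* : ∀ {p q} → 0ℚ ℚ.≤ p → 0ℚ ℚ.≤ q → 0ℚ ℚ.≤ p ℚ.* q
0≤* {p} {q} 0≤p 0≤q = subst (ℚ._≤ p ℚ.* q) (ℚ.*-zeroʳ p) (ℚ.*-monoˡ-≤-nonNeg p {{ℚ.nonNegative 0≤p}} 0≤q)

p≤p+q : ∀ {p q} → 0ℚ ℚ.≤ q → p ℚ.≤ p ℚ.+ q
p≤p+q {p} {q} 0≤q = subst (ℚ._≤ p ℚ.+ q) (ℚ.+-identityʳ p) (ℚ.+-monoʳ-≤ p 0≤q)

-- One step of the expansion of ξ = (P + V √δ) / Q, where κ = 1 / Q; the next complete
-- quotient is (P′ + V √δ) / Q′.
module Quotient {δ : ℕ} {V u P Q κ P′ Q′ e : ℚ}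
  (P+P′≡uQ : P ℚ.+ P′ ≡ u ℚ.* Q)
  (P′²+QQ′≡δV² : P′ ℚ.* P′ ℚ.+ Q ℚ.* Q′ ≡ ι δ ℚ.* (V ℚ.* V))
  (2P′+Q≡Q′+e : P′ ℚ.+ P′ ℚ.+ Q ≡ Q′ ℚ.+ e)
  (Qκ≡1 : Q ℚ.* κ ≡ 1ℚ)
  (0≤V : 0ℚ ℚ.≤ V) (V≢0 : V ≢ 0ℚ) (0≤P′ : 0ℚ ℚ.≤ P′) (0≤Q : 0ℚ ℚ.≤ Q) (0≤Q′ : 0ℚ ℚ.≤ Q′)
  (0≤κ : 0ℚ ℚ.≤ κ) (0≤e : 0ℚ ℚ.≤ e)
  where

  open ≡-Reasoning

  -- This is the rational part of ξ - u = (V √δ - P′) / Q.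
  Pκ-u≡-P′κ : P ℚ.* κ ℚ.- u ≡ ℚ.- (P′ ℚ.* κ)
  Pκ-u≡-P′κ = begin
    P ℚ.* κ ℚ.- u                        ≡⟨ regroup P P′ κ u ⟩
    (P ℚ.+ P′) ℚ.* κ ℚ.- u ℚ.- P′ ℚ.* κ  ≡⟨ cong (λ x → x ℚ.* κ ℚ.- u ℚ.- P′ ℚ.* κ) P+P′≡uQ ⟩
    u ℚ.* Q ℚ.* κ ℚ.- u ℚ.- P′ ℚ.* κ     ≡⟨ cong (λ x → x ℚ.- u ℚ.- P′ ℚ.* κ) (ℚ.*-assoc u Q κ) ⟩
    u ℚ.* (Q ℚ.* κ) ℚ.- u ℚ.- P′ ℚ.* κ   ≡⟨ cong (λ x → u ℚ.* x ℚ.- u ℚ.- P′ ℚ.* κ) Qκ≡1 ⟩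
    u ℚ.* 1ℚ ℚ.- u ℚ.- P′ ℚ.* κ          ≡⟨ cancel u (P′ ℚ.* κ) ⟩
    ℚ.- (P′ ℚ.* κ)                       ∎
    where
    regroup : ∀ P P′ κ u → P ℚ.* κ ℚ.- u ≡ (P ℚ.+ P′) ℚ.* κ ℚ.- u ℚ.- P′ ℚ.* κ
    regroup = solve-∀ ℚ-ring
    cancel : ∀ u x → u ℚ.* 1ℚ ℚ.- u ℚ.- x ≡ ℚ.- x
    cancel = solve-∀ ℚ-ring

  -- Stated for any `v` with the square of `V`, so that it serves `V` in the lower bound and `- V`
  -- in the upper one.
  δV²κ² : ∀ v → v ℚ.* v ≡ V ℚ.* V → ι δ ℚ.* (v ℚ.* κ ℚ.* (v ℚ.* κ)) ≡ (P′ ℚ.* P′ ℚ.+ Q ℚ.* Q′) ℚ.* (κ ℚ.* κ)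
  δV²κ² v v²≡V² = begin
    ι δ ℚ.* (v ℚ.* κ ℚ.* (v ℚ.* κ))         ≡⟨ regroup (ι δ) v κ ⟩
    ι δ ℚ.* (v ℚ.* v) ℚ.* (κ ℚ.* κ)         ≡⟨ cong (λ x → ι δ ℚ.* x ℚ.* (κ ℚ.* κ)) v²≡V² ⟩
    ι δ ℚ.* (V ℚ.* V) ℚ.* (κ ℚ.* κ)         ≡⟨ cong (ℚ._* (κ ℚ.* κ)) P′²+QQ′≡δV² ⟨
    (P′ ℚ.* P′ ℚ.+ Q ℚ.* Q′) ℚ.* (κ ℚ.* κ)  ∎
    where
    regroup : ∀ δ V κ → δ ℚ.* (V ℚ.* κ ℚ.* (V ℚ.* κ)) ≡ δ ℚ.* (V ℚ.* V) ℚ.* (κ ℚ.* κ)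
    regroup = solve-∀ ℚ-ring

  0≤κ² : 0ℚ ℚ.≤ κ ℚ.* κ
  0≤κ² = 0≤* 0≤κ 0≤κ

  -- The claim is P′ ≤ V √δ, up to the factor κ; it holds since δ V² - P′² = Q Q′ is nonnegative.
  floor-≤ : NonNegative {δ} ((P ℚ.* κ ℚ.- u) + (V ℚ.* κ ℚ.- 0ℚ) √)
  floor-≤ = subst₂ (λ x y → NonNegative {δ} (x + y √)) (sym Pκ-u≡-P′κ) (sym (ℚ.+-identityʳ (V ℚ.* κ)))
    (re≤0 (ℚ.neg-antimono-≤ (0≤* 0≤P′ 0≤κ)) (0≤* 0≤V 0≤κ)
      (subst (_ ℚ.≤_) (sym (trans (δV²κ² V refl) (distribute P′ κ (Q ℚ.* Q′))))
        (p≤p+q (0≤* (0≤* 0≤Q 0≤Q′) 0≤κ²))))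
    where
    distribute : ∀ P κ x → (P ℚ.* P ℚ.+ x) ℚ.* (κ ℚ.* κ) ≡ ℚ.- (P ℚ.* κ) ℚ.* ℚ.- (P ℚ.* κ) ℚ.+ x ℚ.* (κ ℚ.* κ)
    distribute = solve-∀ ℚ-ring

  -- The claim is V √δ ≤ P′ + Q, up to the factor κ. After squaring, the difference of the two sides
  -- is Q (2 P′ + Q - Q′) = Q e. Strictness is obtained separately from `Vκ≢0`.
  floor->′ : NonNegative {δ} ((u ℚ.+ 1ℚ ℚ.- P ℚ.* κ) + (0ℚ ℚ.- V ℚ.* κ) √)
  floor->′ = subst₂ (λ x y → NonNegative {δ} (x + y √)) (sym re≡) (negate V κ)
    (im≤0 (0≤* (ℚ.+-mono-≤ 0≤P′ 0≤Q) 0≤κ)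
      (subst (ℚ._≤ 0ℚ) (ℚ.neg-distribˡ-* V κ) (ℚ.neg-antimono-≤ (0≤* 0≤V 0≤κ)))
      (subst₂ ℚ._≤_ (sym (δV²κ² (ℚ.- V) (square V))) (sym square≡)
        (p≤p+q {(P′ ℚ.* P′ ℚ.+ Q ℚ.* Q′) ℚ.* (κ ℚ.* κ)} (0≤* (0≤* 0≤Q 0≤e) 0≤κ²))))
    where
    negate : ∀ V κ → ℚ.- V ℚ.* κ ≡ 0ℚ ℚ.- V ℚ.* κ
    negate = solve-∀ ℚ-ring
    square : ∀ V → ℚ.- V ℚ.* ℚ.- V ≡ V ℚ.* V
    square = solve-∀ ℚ-ring
    swap : ∀ u x → u ℚ.+ 1ℚ ℚ.- x ≡ 1ℚ ℚ.- (x ℚ.- u)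
    swap = solve-∀ ℚ-ring
    collect : ∀ P Q κ → Q ℚ.* κ ℚ.- ℚ.- (P ℚ.* κ) ≡ (P ℚ.+ Q) ℚ.* κ
    collect = solve-∀ ℚ-ring
    re≡ : u ℚ.+ 1ℚ ℚ.- P ℚ.* κ ≡ (P′ ℚ.+ Q) ℚ.* κ
    re≡ = begin
      u ℚ.+ 1ℚ ℚ.- P ℚ.* κ        ≡⟨ swap u (P ℚ.* κ) ⟩
      1ℚ ℚ.- (P ℚ.* κ ℚ.- u)      ≡⟨ cong₂ ℚ._-_ (sym Qκ≡1) Pκ-u≡-P′κ ⟩
      Q ℚ.* κ ℚ.- ℚ.- (P′ ℚ.* κ)  ≡⟨ collect P′ Q κ ⟩
      (P′ ℚ.+ Q) ℚ.* κ            ∎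
    expand : ∀ P Q κ → (P ℚ.+ Q) ℚ.* κ ℚ.* ((P ℚ.+ Q) ℚ.* κ) ≡ (P ℚ.* P ℚ.+ Q ℚ.* (P ℚ.+ P ℚ.+ Q)) ℚ.* (κ ℚ.* κ)
    expand = solve-∀ ℚ-ring
    distribute : ∀ P Q Q′ e κ² → (P ℚ.* P ℚ.+ Q ℚ.* (Q′ ℚ.+ e)) ℚ.* κ² ≡ (P ℚ.* P ℚ.+ Q ℚ.* Q′) ℚ.* κ² ℚ.+ Q ℚ.* e ℚ.* κ²
    distribute = solve-∀ ℚ-ring
    square≡ : (P′ ℚ.+ Q) ℚ.* κ ℚ.* ((P′ ℚ.+ Q) ℚ.* κ) ≡ (P′ ℚ.* P′ ℚ.+ Q ℚ.* Q′) ℚ.* (κ ℚ.* κ) ℚ.+ Q ℚ.* e ℚ.* (κ ℚ.* κ)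
    square≡ = begin
      (P′ ℚ.+ Q) ℚ.* κ ℚ.* ((P′ ℚ.+ Q) ℚ.* κ)                           ≡⟨ expand P′ Q κ ⟩
      (P′ ℚ.* P′ ℚ.+ Q ℚ.* (P′ ℚ.+ P′ ℚ.+ Q)) ℚ.* (κ ℚ.* κ)             ≡⟨ cong (λ x → (P′ ℚ.* P′ ℚ.+ Q ℚ.* x) ℚ.* (κ ℚ.* κ)) 2P′+Q≡Q′+e ⟩
      (P′ ℚ.* P′ ℚ.+ Q ℚ.* (Q′ ℚ.+ e)) ℚ.* (κ ℚ.* κ)                    ≡⟨ distribute P′ Q Q′ e (κ ℚ.* κ) ⟩
      (P′ ℚ.* P′ ℚ.+ Q ℚ.* Q′) ℚ.* (κ ℚ.* κ) ℚ.+ Q ℚ.* e ℚ.* (κ ℚ.* κ)  ∎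

  Vκ≢0 : V ℚ.* κ ≢ 0ℚ
  Vκ≢0 Vκ≡0 = V≢0 (begin
    V                ≡⟨ ℚ.*-identityʳ V ⟨
    V ℚ.* 1ℚ         ≡⟨ cong (V ℚ.*_) Qκ≡1 ⟨
    V ℚ.* (Q ℚ.* κ)  ≡⟨ regroup V Q κ ⟩
    V ℚ.* κ ℚ.* Q    ≡⟨ cong (ℚ._* Q) Vκ≡0 ⟩
    0ℚ ℚ.* Q         ≡⟨ ℚ.*-zeroˡ Q ⟩
    0ℚ               ∎)
    where
    regroup : ∀ V Q κ → V ℚ.* (Q ℚ.* κ) ≡ V ℚ.* κ ℚ.* Q
    regroup = solve-∀ ℚ-ring

  -- (V √δ - P′) (V √δ + P′) = δ V² - P′² = Q Q′.
  ξ-step : ∀ {κ′} → Q′ ℚ.* κ′ ≡ 1ℚ →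
    Defs._*_ {δ} ((P ℚ.* κ ℚ.- u) + (V ℚ.* κ ℚ.- 0ℚ) √) ((P′ ℚ.* κ′) + (V ℚ.* κ′) √) ≡ fromℕ 1
  ξ-step {κ′} Q′κ′≡1 = cong₂ _+_√ re≡ im≡
    where
    regroup : ∀ P κ κ′ δ V → ℚ.- (P ℚ.* κ) ℚ.* (P ℚ.* κ′) ℚ.+ δ ℚ.* ((V ℚ.* κ ℚ.- 0ℚ) ℚ.* (V ℚ.* κ′)) ≡
      (δ ℚ.* (V ℚ.* V) ℚ.- P ℚ.* P) ℚ.* (κ ℚ.* κ′)
    regroup = solve-∀ ℚ-ring
    cancel : ∀ P Q Q′ κ κ′ → (P ℚ.* P ℚ.+ Q ℚ.* Q′ ℚ.- P ℚ.* P) ℚ.* (κ ℚ.* κ′) ≡ (Q ℚ.* κ) ℚ.* (Q′ ℚ.* κ′)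
    cancel = solve-∀ ℚ-ring
    re≡ : (P ℚ.* κ ℚ.- u) ℚ.* (P′ ℚ.* κ′) ℚ.+ ι δ ℚ.* ((V ℚ.* κ ℚ.- 0ℚ) ℚ.* (V ℚ.* κ′)) ≡ 1ℚ
    re≡ = begin
      (P ℚ.* κ ℚ.- u) ℚ.* (P′ ℚ.* κ′) ℚ.+ ι δ ℚ.* ((V ℚ.* κ ℚ.- 0ℚ) ℚ.* (V ℚ.* κ′))
        ≡⟨ cong (λ x → x ℚ.* (P′ ℚ.* κ′) ℚ.+ ι δ ℚ.* ((V ℚ.* κ ℚ.- 0ℚ) ℚ.* (V ℚ.* κ′))) Pκ-u≡-P′κ ⟩
      ℚ.- (P′ ℚ.* κ) ℚ.* (P′ ℚ.* κ′) ℚ.+ ι δ ℚ.* ((V ℚ.* κ ℚ.- 0ℚ) ℚ.* (V ℚ.* κ′))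
        ≡⟨ regroup P′ κ κ′ (ι δ) V ⟩
      (ι δ ℚ.* (V ℚ.* V) ℚ.- P′ ℚ.* P′) ℚ.* (κ ℚ.* κ′)
        ≡⟨ cong (λ x → (x ℚ.- P′ ℚ.* P′) ℚ.* (κ ℚ.* κ′)) P′²+QQ′≡δV² ⟨
      (P′ ℚ.* P′ ℚ.+ Q ℚ.* Q′ ℚ.- P′ ℚ.* P′) ℚ.* (κ ℚ.* κ′)
        ≡⟨ cancel P′ Q Q′ κ κ′ ⟩
      (Q ℚ.* κ) ℚ.* (Q′ ℚ.* κ′)
        ≡⟨ cong₂ ℚ._*_ Qκ≡1 Q′κ′≡1 ⟩
      1ℚ ∎
    vanish : ∀ P κ κ′ V → ℚ.- (P ℚ.* κ) ℚ.* (V ℚ.* κ′) ℚ.+ (V ℚ.* κ ℚ.- 0ℚ) ℚ.* (P ℚ.* κ′) ≡ 0ℚ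
    vanish = solve-∀ ℚ-ring
    im≡ : (P ℚ.* κ ℚ.- u) ℚ.* (V ℚ.* κ′) ℚ.+ (V ℚ.* κ ℚ.- 0ℚ) ℚ.* (P′ ℚ.* κ′) ≡ 0ℚ
    im≡ = trans (cong (λ x → x ℚ.* (V ℚ.* κ′) ℚ.+ (V ℚ.* κ ℚ.- 0ℚ) ℚ.* (P′ ℚ.* κ′)) Pκ-u≡-P′κ) (vanish P′ κ κ′ V)

-- Matrices of periods and their rotations

record Matrix : Set where
  constructor matrix
  field
    m₁₁ m₁₂ m₂₁ m₂₂ : ℕ

open Matrix

matrix-cong : ∀ {a a′ b b′ c c′ d d′} → a ≡ a′ → b ≡ b′ → c ≡ c′ → d ≡ d′ →
  matrix a b c d ≡ matrix a′ b′ c′ d′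
matrix-cong refl refl refl refl = refl

infixr 7 _·_

_·_ : Matrix → Matrix → Matrix
matrix a b c d · matrix a′ b′ c′ d′ =
  matrix (a * a′ + b * c′) (a * b′ + b * d′) (c * a′ + d * c′) (c * b′ + d * d′)

identity : Matrix
identity = matrix 1 0 0 1

letter : ℕ → Matrix
letter u = matrix u 1 1 0

·-assoc : ∀ A B C → (A · B) · C ≡ A · (B · C)
·-assoc (matrix a b c d) (matrix a′ b′ c′ d′) (matrix a″ b″ c″ d″) = matrix-cong
  (entry a b a′ b′ c′ d′ a″ c″) (entry a b a′ b′ c′ d′ b″ d″)
  (entry c d a′ b′ c′ d′ a″ c″) (entry c d a′ b′ c′ d′ b″ d″)
  where
  entry : ∀ a b a′ b′ c′ d′ a″ c″ →
    (a * a′ + b * c′) * a″ + (a * b′ + b * d′) * c″ ≡ a * (a′ * a″ + b′ * c″) + b * (c′ * a″ + d′ * c″)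
  entry = ℕ-Solver.solve-∀

·-identityˡ : ∀ A → identity · A ≡ A
·-identityˡ (matrix a b c d) = matrix-cong (first a c) (first b d) (ℕ.+-identityʳ c) (ℕ.+-identityʳ d)
  where
  first : ∀ a c → 1 * a + 0 * c ≡ a
  first = ℕ-Solver.solve-∀

·-identityʳ : ∀ A → A · identity ≡ A
·-identityʳ (matrix a b c d) = matrix-cong (first a b) (second a b) (first c d) (second c d)
  where
  first : ∀ a b → a * 1 + b * 0 ≡ a
  first = ℕ-Solver.solve-∀
  second : ∀ a b → a * 0 + b * 1 ≡ b
  second = ℕ-Solver.solve-∀

-- (a - d)² + 4 b c, the discriminant of the fixed-point equation of the matrix, is D.
HasDisc : Matrix → ℕ → Set
HasDisc (matrix a b c d) D = a * a + d * d + 4 * (b * c) ≡ D + 2 * (a * d)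

-- The two products are conjugate by `letter u`, so they share trace and determinant, hence also (a
-- - d)² + 4 b c = tr² - 4 det.
HasDisc-rotate : ∀ u N D → HasDisc (letter u · N) D → HasDisc (N · letter u) D
HasDisc-rotate u (matrix p q r t) D h = ℕ.+-cancelʳ-≡ _ _ _ (trans (difference u p q r t) (trans
    (cong (_+ 2 * ((p * u + q * 1) * (r * 1 + t * 0))) h)
    (swap D (2 * ((u * p + 1 * r) * (1 * q + 0 * t))) _)))
  where
  difference : ∀ u p q r t →
    (p * u + q * 1) * (p * u + q * 1) + (r * 1 + t * 0) * (r * 1 + t * 0)
      + 4 * ((p * 1 + q * 0) * (r * u + t * 1)) + 2 * ((u * p + 1 * r) * (1 * q + 0 * t)) ≡
    (u * p + 1 * r) * (u * p + 1 * r) + (1 * q + 0 * t) * (1 * q + 0 * t)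
      + 4 * ((u * q + 1 * t) * (1 * p + 0 * r)) + 2 * ((p * u + q * 1) * (r * 1 + t * 0))
  difference = ℕ-Solver.solve-∀
  swap : ∀ a b c → a + b + c ≡ a + c + b
  swap = ℕ-Solver.solve-∀

module Segment (u : ℕ → ℕ) where

  segment : ℕ → ℕ → Matrix
  segment i zero    = identity
  segment i (suc n) = letter (u i) · segment (suc i) n

  segment-last : ∀ i n → segment i (suc n) ≡ segment i n · letter (u (i + n))
  segment-last i zero    = trans (·-identityʳ _) (trans
    (cong (λ j → letter (u j)) (sym (ℕ.+-identityʳ i))) (sym (·-identityˡ _)))
  segment-last i (suc n) = trans (cong (letter (u i) ·_) (segment-last (suc i) n)) (trans
    (sym (·-assoc (letter (u i)) (segment (suc i) n) (letter (u (suc i + n)))))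
    (cong (λ j → segment i (suc n) · letter (u j)) (sym (ℕ.+-suc i n))))

-- The first row dominates the second; the differences `α` and `β` are kept as data because the
-- slack `e` of the upper floor bound is built from them.
record Reduced (N : Matrix) : Set where
  field
    α β : ℕ
    m₁₁≡ : m₁₁ N ≡ m₂₁ N + α
    m₁₂≡ : m₁₂ N ≡ m₂₂ N + β
    1≤m₁₁ : 1 ≤ m₁₁ N

module _ (u : ℕ → ℕ) (1≤u : ∀ i → 1 ≤ u i) where
  open Segment u

  1≤segment₁₁ : ∀ i n → 1 ≤ m₁₁ (segment i n)
  1≤segment₁₁ i zero    = s≤s z≤n
  1≤segment₁₁ i (suc n) =
    ℕ.≤-trans (ℕ.*-mono-≤ (1≤u i) (1≤segment₁₁ (suc i) n)) (ℕ.m≤m+n _ (1 * m₂₁ (segment (suc i) n)))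

  -- With first letter v + 1, the second row of the product is the first row (p, q) of the remaining
  -- product, and its first row is (v + 1) (p, q) + (r, t).
  segment-reduced : ∀ i n → Reduced (segment i (suc n))
  segment-reduced i n with u i in eq | 1≤u i
  ... | suc v | _ = record
    { α     = v * p + r
    ; β     = v * q + t
    ; m₁₁≡  = column v p r
    ; m₁₂≡  = column v q t
    ; 1≤m₁₁ = subst (λ v → 1 ≤ v * p + 1 * r) eq (1≤segment₁₁ i (suc n))
    }
    where
    open Matrix (segment (suc i) n) renaming (m₁₁ to p; m₁₂ to q; m₂₁ to r; m₂₂ to t)
    column : ∀ v p r → suc v * p + 1 * r ≡ 1 * p + 0 * r + (v * p + r)
    column = ℕ-Solver.solve-∀

ι*1/suc-pred : ∀ {n} → 1 ≤ n → ι n ℚ.* 1/suc (ℕ.pred n) ≡ 1ℚ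
ι*1/suc-pred {suc n} _ = ι*1/suc n

ι-difference : ∀ a d f → a ≡ d + f → ι a ℚ.- ι d ≡ ι f
ι-difference a d f refl = trans (cong (ℚ._- ι d) (ι-+ d f)) (cancel (ι d) (ι f))
  where
  cancel : ∀ d f → d ℚ.+ f ℚ.- d ≡ f
  cancel = solve-∀ ℚ-ring

-- letter u · N is the matrix of a rotation of the period, N · letter u that of the next one.
module Rotation {δ V : ℕ} (V≢0 : V ≢ 0) (u : ℕ) (1≤u : 1 ≤ u) (N : Matrix) (red : Reduced N)
  (disc : HasDisc (letter u · N) (δ * (V * V))) where
  open Reduced red
  open Matrix N renaming (m₁₁ to p; m₁₂ to q; m₂₁ to r; m₂₂ to t)
  open Matrix (letter u · N) renaming (m₁₁ to a; m₁₂ to b; m₂₁ to c; m₂₂ to d)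
  open Matrix (N · letter u) renaming (m₁₁ to a′; m₁₂ to b′; m₂₁ to c′; m₂₂ to d′)

  sum : ι a ℚ.- ι d ℚ.+ (ι a′ ℚ.- ι d′) ≡ ι u ℚ.* ι (2 * c)
  sum = begin
    ι a ℚ.- ι d ℚ.+ (ι a′ ℚ.- ι d′)  ≡⟨ regroup (ι a) (ι d) (ι a′) (ι d′) ⟩
    ι a ℚ.+ ι a′ ℚ.- (ι d ℚ.+ ι d′)  ≡⟨ cong₂ ℚ._-_ (ι-+ a a′) (ι-+ d d′) ⟨
    ι (a + a′) ℚ.- ι (d + d′)        ≡⟨ ι-difference (a + a′) (d + d′) (u * (2 * c)) (sum-ℕ u p q r t) ⟩
    ι (u * (2 * c))                  ≡⟨ ι-* u (2 * c) ⟩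
    ι u ℚ.* ι (2 * c)                ∎
    where
    open ≡-Reasoning
    sum-ℕ : ∀ u p q r t → u * p + 1 * r + (p * u + q * 1) ≡
      1 * q + 0 * t + (r * 1 + t * 0) + u * (2 * (1 * p + 0 * r))
    sum-ℕ = ℕ-Solver.solve-∀
    regroup : ∀ a d a′ d′ → a ℚ.- d ℚ.+ (a′ ℚ.- d′) ≡ a ℚ.+ a′ ℚ.- (d ℚ.+ d′)
    regroup = solve-∀ ℚ-ring

  -- Both `c` and `b′` equal `p`, so the left side is (a′ - d′)² + 4 b′ c′, the discriminant of
  -- `N · letter u`, which rotation leaves unchanged.
  norm : (ι a′ ℚ.- ι d′) ℚ.* (ι a′ ℚ.- ι d′) ℚ.+ ι (2 * c) ℚ.* ι (2 * c′) ≡ ι δ ℚ.* (ι V ℚ.* ι V)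
  norm = begin
    (ι a′ ℚ.- ι d′) ℚ.* (ι a′ ℚ.- ι d′) ℚ.+ ι (2 * c) ℚ.* ι (2 * c′)
      ≡⟨ regroup (ι a′) (ι d′) (ι (2 * c)) (ι (2 * c′)) ⟩
    ι a′ ℚ.* ι a′ ℚ.+ ι d′ ℚ.* ι d′ ℚ.+ ι (2 * c) ℚ.* ι (2 * c′) ℚ.- (1ℚ ℚ.+ 1ℚ) ℚ.* (ι a′ ℚ.* ι d′)
      ≡⟨ cong₂ ℚ._-_ (trans (ι-+ (a′ * a′ + d′ * d′) (2 * c * (2 * c′)))
           (cong₂ ℚ._+_ (trans (ι-+ (a′ * a′) (d′ * d′)) (cong₂ ℚ._+_ (ι-* a′ a′) (ι-* d′ d′)))
             (ι-* (2 * c) (2 * c′))))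
           (trans (ι-* 2 (a′ * d′)) (cong (ι 2 ℚ.*_) (ι-* a′ d′))) ⟨
    ι (a′ * a′ + d′ * d′ + 2 * c * (2 * c′)) ℚ.- ι (2 * (a′ * d′))
      ≡⟨ ι-difference _ (2 * (a′ * d′)) (δ * (V * V)) (trans
           (offdiagonal (a′ * a′ + d′ * d′) p q r c′)
           (trans (HasDisc-rotate u N (δ * (V * V)) disc) (ℕ.+-comm (δ * (V * V)) _))) ⟩
    ι (δ * (V * V))
      ≡⟨ trans (ι-* δ (V * V)) (cong (ι δ ℚ.*_) (ι-* V V)) ⟩
    ι δ ℚ.* (ι V ℚ.* ι V) ∎
    where
    open ≡-Reasoning
    regroup : ∀ a d x y → (a ℚ.- d) ℚ.* (a ℚ.- d) ℚ.+ x ℚ.* y ≡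
      a ℚ.* a ℚ.+ d ℚ.* d ℚ.+ x ℚ.* y ℚ.- (1ℚ ℚ.+ 1ℚ) ℚ.* (a ℚ.* d)
    regroup = solve-∀ ℚ-ring
    offdiagonal : ∀ s p q r c′ → s + 2 * (1 * p + 0 * r) * (2 * c′) ≡ s + 4 * ((p * 1 + q * 0) * c′)
    offdiagonal = ℕ-Solver.solve-∀

  -- This is 2 (a′ - d′) + 2 c - 2 c′, rewritten with p = r + α and q = t + β so that it is visibly
  -- nonnegative.
  e : ℕ
  e = 2 * (α * u + β + α)

  bound : ι a′ ℚ.- ι d′ ℚ.+ (ι a′ ℚ.- ι d′) ℚ.+ ι (2 * c) ≡ ι (2 * c′) ℚ.+ ι e
  bound = begin
    ι a′ ℚ.- ι d′ ℚ.+ (ι a′ ℚ.- ι d′) ℚ.+ ι (2 * c)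
      ≡⟨ regroup (ι a′) (ι d′) (ι (2 * c)) ⟩
    ι a′ ℚ.+ ι a′ ℚ.+ ι (2 * c) ℚ.- (ι d′ ℚ.+ ι d′)
      ≡⟨ cong₂ ℚ._-_ (trans (ι-+ (a′ + a′) (2 * c)) (cong (ℚ._+ ι (2 * c)) (ι-+ a′ a′))) (ι-+ d′ d′) ⟨
    ι (a′ + a′ + 2 * c) ℚ.- ι (d′ + d′)
      ≡⟨ ι-difference _ (d′ + d′) (2 * c′ + e) bound-ℕ ⟩
    ι (2 * c′ + e)
      ≡⟨ ι-+ (2 * c′) e ⟩
    ι (2 * c′) ℚ.+ ι e ∎
    where
    open ≡-Reasoning
    regroup : ∀ a d x → a ℚ.- d ℚ.+ (a ℚ.- d) ℚ.+ x ≡ a ℚ.+ a ℚ.+ x ℚ.- (d ℚ.+ d)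
    regroup = solve-∀ ℚ-ring
    identity-ℕ : ∀ u r t α β →
      (r + α) * u + (t + β) * 1 + ((r + α) * u + (t + β) * 1) + 2 * (1 * (r + α) + 0 * r) ≡
      r * 1 + t * 0 + (r * 1 + t * 0) + (2 * (r * u + t * 1) + 2 * (α * u + β + α))
    identity-ℕ = ℕ-Solver.solve-∀
    bound-ℕ : a′ + a′ + 2 * c ≡ d′ + d′ + (2 * c′ + e)
    bound-ℕ = trans
      (cong₂ (λ p q → p * u + q * 1 + (p * u + q * 1) + 2 * (1 * p + 0 * r)) m₁₁≡ m₁₂≡)
      (identity-ℕ u r t α β)

  -- Here a′ - d′ = p u + q - r, with u ≥ 1 and p = r + α.
  0≤P′ : 0ℚ ℚ.≤ ι a′ ℚ.- ι d′
  0≤P′ = nonneg u 1≤u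
    where
    identity-ℕ : ∀ v q r t α → (r + α) * suc v + q * 1 ≡ r * 1 + t * 0 + ((r + α) * v + α + q)
    identity-ℕ = ℕ-Solver.solve-∀
    nonneg : ∀ u → 1 ≤ u → 0ℚ ℚ.≤ ι (p * u + q * 1) ℚ.- ι d′
    nonneg (suc v) _ = subst (0ℚ ℚ.≤_)
      (sym (ι-difference _ d′ ((r + α) * v + α + q)
        (trans (cong (λ p → p * suc v + q * 1) m₁₁≡) (identity-ℕ v q r t α))))
      (0≤ι ((r + α) * v + α + q))

  1≤2c : 1 ≤ 2 * c
  1≤2c = ℕ.≤-trans 1≤m₁₁ (subst (p ≤_) (double p r) (ℕ.m≤m+n p p))
    where
    double : ∀ p r → p + p ≡ 2 * (1 * p + 0 * r)
    double = ℕ-Solver.solve-∀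

  open Quotient {δ} {ι V} {ι u} {ι a ℚ.- ι d} {ι (2 * c)} {1/suc (ℕ.pred (2 * c))}
    {ι a′ ℚ.- ι d′} {ι (2 * c′)} {ι e} sum norm bound (ι*1/suc-pred 1≤2c) (0≤ι V) (λ ιV≡0 → V≢0 (ι-injective ιV≡0))
    0≤P′ (0≤ι (2 * c)) (0≤ι (2 * c′)) (0≤1/suc (ℕ.pred (2 * c))) (0≤ι e) public

-- When the discriminant is δ V² and c is positive, this is the larger root of c z² - (a - d) z - b
-- = 0, that is, of the fixed-point equation z = (a z + b) / (c z + d).
quotient : ∀ {δ} → ℕ → Matrix → ℚ[√ δ ]
quotient V (matrix a b c d) =
  ((ι a ℚ.- ι d) ℚ.* 1/suc (ℕ.pred (2 * c))) + (ι V ℚ.* 1/suc (ℕ.pred (2 * c))) √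

module Periodic {δ V : ℕ} (u : ℕ → ℕ) (1≤u : ∀ i → 1 ≤ u i) (n : ℕ)
  (periodic : ∀ i → u (i + suc (suc n)) ≡ u i) (V≢0 : V ≢ 0)
  (disc : HasDisc (Segment.segment u 0 (suc (suc n))) (δ * (V * V))) where
  open Segment u

  -- The period has n + 2 letters, so what follows its first letter is a nonempty product and
  -- therefore `Reduced`.
  tail : ℕ → Matrix
  tail i = segment (suc i) (suc n)

  -- By periodicity the letter removed at the front is the one that the next rotation has at its
  -- end.
  tail-rotate : ∀ i → tail i · letter (u i) ≡ letter (u (suc i)) · tail (suc i)
  tail-rotate i = trans
    (cong (λ v → tail i · letter v) (trans (sym (periodic i)) (cong u (ℕ.+-suc i (suc n)))))
    (sym (segment-last (suc i) (suc n)))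

  disc-rotation : ∀ i → HasDisc (letter (u i) · tail i) (δ * (V * V))
  disc-rotation zero    = disc
  disc-rotation (suc i) = subst (λ M → HasDisc M (δ * (V * V))) (tail-rotate i)
    (HasDisc-rotate (u i) (tail i) (δ * (V * V)) (disc-rotation i))

  module R (i : ℕ) = Rotation {δ} {V} V≢0 (u i) (1≤u i) (tail i) (segment-reduced u 1≤u (suc i) n) (disc-rotation i)

  ξ : ℕ → ℚ[√ δ ]
  ξ i = quotient V (letter (u i) · tail i)

  ι-suc : ∀ m → ι m ℚ.+ 1ℚ ≡ ι (suc m)
  ι-suc m = trans (ℚ.+-comm (ι m) 1ℚ) (sym (ι-+ 1 m))

  1≤2c′ : ∀ i → 1 ≤ 2 * m₂₁ (tail i · letter (u i))
  1≤2c′ i = subst (λ M → 1 ≤ 2 * m₂₁ M) (sym (tail-rotate i)) (R.1≤2c (suc i))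

  hasExpansion : ξ 0 HasExpansion u
  hasExpansion = record
    { ξ       = ξ
    ; ξ-zero  = refl
    ; floor-≤ = λ i → R.floor-≤ i
    ; floor-> = λ i →
        subst (λ x → NonNegative {δ} (x Defs.- ξ i)) (cong (_+ 0ℚ √) (ι-suc (u i))) (R.floor->′ i) ,
        -- Equality with an integer would make the coefficient of √δ vanish.
        λ eq → R.Vκ≢0 i (cong ℚ[√_].im eq)
    -- `Rotation` yields the quotient of `tail i · letter (u i)`, which is the matrix of the next
    -- rotation.
    ; ξ-suc   = λ i → subst (λ M → (ξ i Defs.- fromℕ (u i)) Defs.* quotient V M ≡ fromℕ 1) (tail-rotate i)
        (R.ξ-step i (ι*1/suc-pred (1≤2c′ i)))
    }

-- The period of the theorem

word : List ℕ → Matrix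
word []      = identity
word (u ∷ w) = letter u · word w

word-++ : ∀ v w → word (v ++ w) ≡ word v · word w
word-++ []      w = sym (·-identityˡ (word w))
word-++ (u ∷ v) w = trans (cong (letter u ·_) (word-++ v w)) (sym (·-assoc (letter u) (word v) (word w)))

segment-word : ∀ u i w → (∀ k → u (i + toℕ k) ≡ lookup w k) → Segment.segment u i (length w) ≡ word w
segment-word u i []      _       = refl
segment-word u i (x ∷ w) u≡lookup = cong₂ (λ v M → letter v · M)
  (trans (cong u (sym (ℕ.+-identityʳ i))) (u≡lookup zero))
  (segment-word u (suc i) w (λ k → trans (cong u (sym (ℕ.+-suc i (toℕ k)))) (u≡lookup (suc k))))

module _ (w : List ℕ) .{{_ : NonZero (length w)}} where

  cycle-toℕ : ∀ k → cycle w (toℕ k) ≡ lookup w k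
  cycle-toℕ k = cong (lookup w)
    (Fin.toℕ-injective (trans (Fin.toℕ-fromℕ< _) (m<n⇒m%n≡m (Fin.toℕ<n k))))

  cycle-periodic : ∀ i → cycle w (i + length w) ≡ cycle w i
  cycle-periodic i = cong (lookup w) (Fin.toℕ-injective
    (trans (Fin.toℕ-fromℕ< _) (trans ([m+n]%n≡m%n i (length w)) (sym (Fin.toℕ-fromℕ< _)))))

  cycle-All : ∀ {P : ℕ → Set} → All P w → ∀ i → P (cycle w i)
  cycle-All ps i = All.lookup ps (∈-lookup (i mod length w))

-- Two letters are displayed because `Periodic` is set up for periods of length n + 2.
overline∈ℚ[√] : ∀ {δ} V x y w → All (1 ≤_) (x ∷ y ∷ w) → V ≢ 0 →
  HasDisc (word (x ∷ y ∷ w)) (δ * (V * V)) → [overline x ∷ y ∷ w ]∈ℚ[√ δ ]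
overline∈ℚ[√] {δ} V x y w 1≤w V≢0 disc = _ , Periodic.hasExpansion {δ} {V} (cycle v)
  (cycle-All v 1≤w) (length w) (cycle-periodic v) V≢0
  (subst (λ M → HasDisc M (δ * (V * V))) (sym (segment-word (cycle v) 0 v (cycle-toℕ v))) disc)
  where
  v : List ℕ
  v = x ∷ y ∷ w

Unimodular : Matrix → Set
Unimodular (matrix a b c d) = a * d ≡ b * c + 1

-- Multiplicativity of the determinant; the negative terms of (a d - b c) (a′ d′ - b′ c′) are added
-- on both sides, as there is no subtraction in ℕ.
·-unimodular : ∀ A B → Unimodular A → Unimodular B → Unimodular (A · B)
·-unimodular (matrix a b c d) (matrix a′ b′ c′ d′) ad≡ a′d′≡ = ℕ.+-cancelʳ-≡ _ _ _ (begin
  (a * a′ + b * c′) * (c * b′ + d * d′) + (a * d * (b′ * c′) + b * c * (a′ * d′))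
    ≡⟨ det-product a b c d a′ b′ c′ d′ ⟩
  (a * b′ + b * d′) * (c * a′ + d * c′) + (a * d * (a′ * d′) + b * c * (b′ * c′))
    ≡⟨ cong (λ x → (a * b′ + b * d′) * (c * a′ + d * c′) + x)
         (cong₂ (λ x y → x * y + b * c * (b′ * c′)) ad≡ a′d′≡) ⟩
  (a * b′ + b * d′) * (c * a′ + d * c′) + ((b * c + 1) * (b′ * c′ + 1) + b * c * (b′ * c′))
    ≡⟨ rearrange ((a * b′ + b * d′) * (c * a′ + d * c′)) (b * c) (b′ * c′) ⟩
  (a * b′ + b * d′) * (c * a′ + d * c′) + 1 + ((b * c + 1) * (b′ * c′) + b * c * (b′ * c′ + 1))
    ≡⟨ cong (λ x → (a * b′ + b * d′) * (c * a′ + d * c′) + 1 + x)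
         (cong₂ (λ x y → x * (b′ * c′) + b * c * y) ad≡ a′d′≡) ⟨
  (a * b′ + b * d′) * (c * a′ + d * c′) + 1 + (a * d * (b′ * c′) + b * c * (a′ * d′)) ∎)
  where
  open ≡-Reasoning
  det-product : ∀ a b c d a′ b′ c′ d′ →
    (a * a′ + b * c′) * (c * b′ + d * d′) + (a * d * (b′ * c′) + b * c * (a′ * d′)) ≡
    (a * b′ + b * d′) * (c * a′ + d * c′) + (a * d * (a′ * d′) + b * c * (b′ * c′))
  det-product = ℕ-Solver.solve-∀
  rearrange : ∀ z e e′ → z + ((e + 1) * (e′ + 1) + e * e′) ≡ z + 1 + ((e + 1) * e′ + e * (e′ + 1))
  rearrange = ℕ-Solver.solve-∀

-- (a - d)² + 4 b c = tr² - 4 det, here with determinant 1.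
unimodular⇒HasDisc : ∀ M {D} → Unimodular M → (m₁₁ M + m₂₂ M) * (m₁₁ M + m₂₂ M) ≡ D + 4 → HasDisc M D
unimodular⇒HasDisc (matrix a b c d) {D} ad≡ tr² = ℕ.+-cancelʳ-≡ 4 _ _ (begin
  a * a + d * d + 4 * (b * c) + 4  ≡⟨ factor (a * a + d * d) (b * c) ⟩
  a * a + d * d + 4 * (b * c + 1)  ≡⟨ cong (λ x → a * a + d * d + 4 * x) ad≡ ⟨
  a * a + d * d + 4 * (a * d)      ≡⟨ complete a d ⟩
  (a + d) * (a + d) + 2 * (a * d)  ≡⟨ cong (_+ 2 * (a * d)) tr² ⟩
  D + 4 + 2 * (a * d)              ≡⟨ swap D (2 * (a * d)) ⟩
  D + 2 * (a * d) + 4              ∎)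
  where
  open ≡-Reasoning
  factor : ∀ x y → x + 4 * y + 4 ≡ x + 4 * (y + 1)
  factor = ℕ-Solver.solve-∀
  complete : ∀ a d → a * a + d * d + 4 * (a * d) ≡ (a + d) * (a + d) + 2 * (a * d)
  complete = ℕ-Solver.solve-∀
  swap : ∀ x y → x + 4 + y ≡ x + y + 4
  swap = ℕ-Solver.solve-∀

module Pattern (s : ℕ) where

  block blockᵀ center : List ℕ
  block  = s ∷ 1 ∷ 1 ∷ 2 ∷ 1 ∷ 1 ∷ []
  blockᵀ = 1 ∷ 1 ∷ 2 ∷ 1 ∷ 1 ∷ s ∷ []
  center = s ∷ 1 ∷ 2 ∷ 1 ∷ 1 ∷ 1 ∷ 1 ∷ s ∷ []

  -- The matrices commuting with word block are, up to scale, those of this form.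
  power powerᵀ : ℕ → ℕ → Matrix
  power  t ρ = matrix (t + 12 * s * ρ) ((7 * s + 4) * ρ) (12 * ρ) t
  powerᵀ t ρ = matrix (t + 12 * s * ρ) (12 * ρ) ((7 * s + 4) * ρ) t

  -- If B is the matrix of `block`, the lower row of Bⁿ is (12 ρ, t); the recursion is the lower row
  -- of B · Bⁿ.
  t ρ : ℕ → ℕ
  t zero    = 1
  t (suc n) = 7 * t n + 12 * (7 * s + 4) * ρ n
  ρ zero    = 0
  ρ (suc n) = t n + (12 * s + 7) * ρ n

  word-block : word block ≡ matrix (12 * s + 7) (7 * s + 4) 12 7
  word-block = matrix-cong (first s) (second s) refl refl
    where
    first : ∀ s → s * 12 + 7 ≡ 12 * s + 7
    first = ℕ-Solver.solve-∀
    second : ∀ s → s * 7 + 4 ≡ 7 * s + 4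
    second = ℕ-Solver.solve-∀

  word-blockᵀ : word blockᵀ ≡ matrix (12 * s + 7) 12 (7 * s + 4) 7
  -- Once the last letter is split off, the closed word 1, 1, 2, 1, 1 evaluates to the symmetric
  -- matrix (12 7; 7 4).
  word-blockᵀ = trans (word-++ (1 ∷ 1 ∷ 2 ∷ 1 ∷ 1 ∷ []) (s ∷ []))
    (matrix-cong (first s) (second s) (third s) (fourth s))
    where
    first : ∀ s → 12 * (s * 1 + 0) + 7 ≡ 12 * s + 7
    first = ℕ-Solver.solve-∀
    second : ∀ s → 12 * (s * 0 + 1) + 0 ≡ 12
    second = ℕ-Solver.solve-∀
    third : ∀ s → 7 * (s * 1 + 0) + 4 ≡ 7 * s + 4
    third = ℕ-Solver.solve-∀
    fourth : ∀ s → 7 * (s * 0 + 1) + 0 ≡ 7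
    fourth = ℕ-Solver.solve-∀

  Y : Matrix
  Y = matrix (18 * s * s + 24 * s + 8) (18 * s + 13) (18 * s + 11) 18

  word-center : word center ≡ Y
  word-center = trans
    (cong (letter s ·_) (word-++ (1 ∷ 2 ∷ 1 ∷ 1 ∷ 1 ∷ 1 ∷ []) (s ∷ [])))
    (matrix-cong (first s) (second s) (third s) (fourth s))
    where
    first : ∀ s → s * (18 * (s * 1 + 0) + 11) + 1 * (13 * (s * 1 + 0) + 8) ≡ 18 * s * s + 24 * s + 8
    first = ℕ-Solver.solve-∀
    second : ∀ s → s * (18 * (s * 0 + 1) + 0) + 1 * (13 * (s * 0 + 1) + 0) ≡ 18 * s + 13
    second = ℕ-Solver.solve-∀
    third : ∀ s → 1 * (18 * (s * 1 + 0) + 11) + 0 * (13 * (s * 1 + 0) + 8) ≡ 18 * s + 11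
    third = ℕ-Solver.solve-∀
    fourth : ∀ s → 1 * (18 * (s * 0 + 1) + 0) + 0 * (13 * (s * 0 + 1) + 0) ≡ 18
    fourth = ℕ-Solver.solve-∀

  word-block^ : ∀ n → word (block ^^ n) ≡ power (t n) (ρ n)
  word-block^ zero    = matrix-cong (corner s) (sym (ℕ.*-zeroʳ (7 * s + 4))) refl refl
    where
    corner : ∀ s → 1 ≡ 1 + 12 * s * 0
    corner = ℕ-Solver.solve-∀
  word-block^ (suc n) = trans (word-++ block (block ^^ n)) (trans
    (cong₂ _·_ word-block (word-block^ n))
    (matrix-cong (e₁₁ s (t n) (ρ n)) (e₁₂ s (t n) (ρ n)) (e₂₁ s (t n) (ρ n)) (e₂₂ s (t n) (ρ n))))
    where
    e₁₁ : ∀ s t ρ → (12 * s + 7) * (t + 12 * s * ρ) + (7 * s + 4) * (12 * ρ) ≡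
      7 * t + 12 * (7 * s + 4) * ρ + 12 * s * (t + (12 * s + 7) * ρ)
    e₁₁ = ℕ-Solver.solve-∀
    e₁₂ : ∀ s t ρ → (12 * s + 7) * ((7 * s + 4) * ρ) + (7 * s + 4) * t ≡ (7 * s + 4) * (t + (12 * s + 7) * ρ)
    e₁₂ = ℕ-Solver.solve-∀
    e₂₁ : ∀ s t ρ → 12 * (t + 12 * s * ρ) + 7 * (12 * ρ) ≡ 12 * (t + (12 * s + 7) * ρ)
    e₂₁ = ℕ-Solver.solve-∀
    e₂₂ : ∀ s t ρ → 12 * ((7 * s + 4) * ρ) + 7 * t ≡ 7 * t + 12 * (7 * s + 4) * ρ
    e₂₂ = ℕ-Solver.solve-∀

  word-blockᵀ^ : ∀ n → word (blockᵀ ^^ n) ≡ powerᵀ (t n) (ρ n)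
  word-blockᵀ^ zero    = matrix-cong (corner s) refl (sym (ℕ.*-zeroʳ (7 * s + 4))) refl
    where
    corner : ∀ s → 1 ≡ 1 + 12 * s * 0
    corner = ℕ-Solver.solve-∀
  word-blockᵀ^ (suc n) = trans (word-++ blockᵀ (blockᵀ ^^ n)) (trans
    (cong₂ _·_ word-blockᵀ (word-blockᵀ^ n))
    (matrix-cong (e₁₁ s (t n) (ρ n)) (e₁₂ s (t n) (ρ n)) (e₂₁ s (t n) (ρ n)) (e₂₂ s (t n) (ρ n))))
    where
    e₁₁ : ∀ s t ρ → (12 * s + 7) * (t + 12 * s * ρ) + 12 * ((7 * s + 4) * ρ) ≡
      7 * t + 12 * (7 * s + 4) * ρ + 12 * s * (t + (12 * s + 7) * ρ)
    e₁₁ = ℕ-Solver.solve-∀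
    e₁₂ : ∀ s t ρ → (12 * s + 7) * (12 * ρ) + 12 * t ≡ 12 * (t + (12 * s + 7) * ρ)
    e₁₂ = ℕ-Solver.solve-∀
    e₂₁ : ∀ s t ρ → (7 * s + 4) * (t + 12 * s * ρ) + 7 * ((7 * s + 4) * ρ) ≡ (7 * s + 4) * (t + (12 * s + 7) * ρ)
    e₂₁ = ℕ-Solver.solve-∀
    e₂₂ : ∀ s t ρ → (7 * s + 4) * (12 * ρ) + 7 * t ≡ 7 * t + 12 * (7 * s + 4) * ρ
    e₂₂ = ℕ-Solver.solve-∀

  -- `matrix 8 5 3 2` is the word of the initial letters 2, 1, 1, 1.
  product : ℕ → ℕ → Matrix
  product t ρ = matrix 8 5 3 2 · (power t ρ · (Y · powerᵀ t ρ))

  word-period : ∀ n → word (period s n) ≡ product (t n) (ρ n)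
  word-period n = trans (word-++ (2 ∷ 1 ∷ 1 ∷ 1 ∷ []) (block ^^ n ++ center ++ blockᵀ ^^ n))
    (cong (matrix 8 5 3 2 ·_) (trans (word-++ (block ^^ n) (center ++ blockᵀ ^^ n))
      (cong₂ _·_ (word-block^ n) (trans (word-++ center (blockᵀ ^^ n))
        (cong₂ _·_ word-center (word-blockᵀ^ n))))))

  power-unimodular : ∀ n → Unimodular (power (t n) (ρ n))
  power-unimodular zero    = start s
    where
    start : ∀ s → (1 + 12 * s * 0) * 1 ≡ (7 * s + 4) * 0 * 0 + 1
    start = ℕ-Solver.solve-∀
  power-unimodular (suc n) = subst Unimodular
    (trans (cong₂ _·_ (sym word-block) (sym (word-block^ n)))
      (trans (sym (word-++ block (block ^^ n))) (word-block^ (suc n))))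
    (·-unimodular (matrix (12 * s + 7) (7 * s + 4) 12 7) (power (t n) (ρ n)) (det s) (power-unimodular n))
    where
    det : ∀ s → (12 * s + 7) * 7 ≡ (7 * s + 4) * 12 + 1
    det = ℕ-Solver.solve-∀

  powerᵀ-unimodular : ∀ n → Unimodular (powerᵀ (t n) (ρ n))
  powerᵀ-unimodular n = trans (power-unimodular n)
    (cong (_+ 1) (ℕ.*-comm ((7 * s + 4) * ρ n) (12 * ρ n)))

  product-unimodular : ∀ n → Unimodular (product (t n) (ρ n))
  product-unimodular n = ·-unimodular (matrix 8 5 3 2) (power (t n) (ρ n) · (Y · powerᵀ (t n) (ρ n))) refl
    (·-unimodular (power (t n) (ρ n)) (Y · powerᵀ (t n) (ρ n)) (power-unimodular n)
      (·-unimodular Y (powerᵀ (t n) (ρ n)) (det s) (powerᵀ-unimodular n)))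
    where
    det : ∀ s → (18 * s * s + 24 * s + 8) * 18 ≡ (18 * s + 13) * (18 * s + 11) + 1
    det = ℕ-Solver.solve-∀

  -- word block has the eigenvalues ε, 1/ε = x ± √(x² - 1) with x = 6 s + 7;
  -- halfTrace n and ρ (suc n) are (εⁿ⁺¹ + ε⁻ⁿ⁻¹) / 2 and (εⁿ⁺¹ - ε⁻ⁿ⁻¹) / (ε - 1/ε).
  halfTrace : ℕ → ℕ
  halfTrace n = t (suc n) + 6 * s * ρ (suc n)

  -- The trace and the right side are homogeneous quadratic in t and ρ. Replacing the constant 2 by
  -- twice the determinant of `power` makes the claim a polynomial identity.
  trace-product : ∀ n → let M = product (t n) (ρ n) in m₁₁ M + m₂₂ M + 2 ≡ 4 * (halfTrace n * halfTrace n)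
  trace-product n = ℕ.+-cancelʳ-≡ (2 * ((7 * s + 4) * ρ n * (12 * ρ n))) _ _ (trans
    (regroup (m₁₁ M + m₂₂ M) ((7 * s + 4) * ρ n * (12 * ρ n)))
    (trans (cong (λ x → m₁₁ M + m₂₂ M + 2 * x) (sym (power-unimodular n))) (identity-ℕ s (t n) (ρ n))))
    where
    M : Matrix
    M = product (t n) (ρ n)
    regroup : ∀ x y → x + 2 + 2 * y ≡ x + 2 * (y + 1)
    regroup = ℕ-Solver.solve-∀
    identity-ℕ : ∀ s t ρ →
      let a = t + 12 * s * ρ ; b = (7 * s + 4) * ρ ; c = 12 * ρ
          p = (18 * s * s + 24 * s + 8) * a + (18 * s + 13) * b
          q = (18 * s * s + 24 * s + 8) * c + (18 * s + 13) * t
          r = (18 * s + 11) * a + 18 * b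
          u = (18 * s + 11) * c + 18 * t
          T = 7 * t + 12 * (7 * s + 4) * ρ + 6 * s * (t + (12 * s + 7) * ρ)
      in 8 * (a * p + b * r) + 5 * (c * p + t * r) + (3 * (a * q + b * u) + 2 * (c * q + t * u))
           + 2 * (a * t) ≡ 4 * (T * T) + 2 * (b * c)
    identity-ℕ = ℕ-Solver.solve-∀

  -- Completing the square, the determinant of `power t ρ` is (t + 6 s ρ)² - (36 s² + 84 s + 48) ρ²,
  -- and the coefficient is x² - 1 for x = 6 s + 7. The proof reduces the determinant at `suc n` to
  -- the one at `n`.
  halfTrace-norm : ∀ n → halfTrace n * halfTrace n ≡ (36 * s * s + 84 * s + 48) * (ρ (suc n) * ρ (suc n)) + 1
  halfTrace-norm n = ℕ.+-cancelʳ-≡ ((7 * s + 4) * ρ n * (12 * ρ n)) _ _ (trans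
    (identity-ℕ s (t n) (ρ n))
    (trans (cong (λ x → norm + x) (power-unimodular n)) (regroup norm ((7 * s + 4) * ρ n * (12 * ρ n)))))
    where
    norm : ℕ
    norm = (36 * s * s + 84 * s + 48) * (ρ (suc n) * ρ (suc n))
    regroup : ∀ x y → x + (y + 1) ≡ x + 1 + y
    regroup = ℕ-Solver.solve-∀
    identity-ℕ : ∀ s t ρ →
      let W = t + (12 * s + 7) * ρ
          T = 7 * t + 12 * (7 * s + 4) * ρ + 6 * s * W
      in T * T + (7 * s + 4) * ρ * (12 * ρ) ≡ (36 * s * s + 84 * s + 48) * (W * W) + (t + 12 * s * ρ) * t
    identity-ℕ = ℕ-Solver.solve-∀

  t≢0 : ∀ n → t n ≢ 0
  t≢0 n t≡0 = ℕ.1+n≢0 (begin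
    1 + b * c                   ≡⟨ ℕ.+-comm 1 (b * c) ⟩
    b * c + 1                   ≡⟨ power-unimodular n ⟨
    (t n + 12 * s * ρ n) * t n  ≡⟨ cong ((t n + 12 * s * ρ n) *_) t≡0 ⟩
    (t n + 12 * s * ρ n) * 0    ≡⟨ ℕ.*-zeroʳ (t n + 12 * s * ρ n) ⟩
    0                           ∎)
    where
    open ≡-Reasoning
    b c : ℕ
    b = (7 * s + 4) * ρ n
    c = 12 * ρ n

  1≤halfTrace : ∀ n → 1 ≤ halfTrace n
  1≤halfTrace n = ℕ.≤-trans (ℕ.n≢0⇒n>0 (t≢0 (suc n))) (ℕ.m≤m+n (t (suc n)) (6 * s * ρ (suc n)))

  1≤ρ : ∀ n → 1 ≤ ρ (suc n)
  1≤ρ n = ℕ.≤-trans (ℕ.n≢0⇒n>0 (t≢0 n)) (ℕ.m≤m+n (t n) ((12 * s + 7) * ρ n))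

  period-positive : 1 ≤ s → ∀ n → All (1 ≤_) (period s n)
  period-positive 1≤s n = 1≤2 ∷ 1≤1 ∷ 1≤1 ∷ 1≤1 ∷ All.++⁺
    (All.concat⁺ (All.replicate⁺ n (1≤s ∷ 1≤1 ∷ 1≤1 ∷ 1≤2 ∷ 1≤1 ∷ 1≤1 ∷ [])))
    (All.++⁺ (1≤s ∷ 1≤1 ∷ 1≤2 ∷ 1≤1 ∷ 1≤1 ∷ 1≤1 ∷ 1≤1 ∷ 1≤s ∷ [])
      (All.concat⁺ (All.replicate⁺ n (1≤1 ∷ 1≤1 ∷ 1≤2 ∷ 1≤1 ∷ 1≤1 ∷ 1≤s ∷ []))))
    where
    1≤1 : 1 ≤ 1
    1≤1 = s≤s z≤n
    1≤2 : 1 ≤ 2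
    1≤2 = s≤s z≤n

  module _ {δ y : ℕ} (pell : (6 * s + 7) * (6 * s + 7) ≡ δ * (y * y) + 1) where

    -- With T = `halfTrace n`, Pell's equation turns T² - 1 into δ (y ρ)², so 16 T² (T² - 1) is δ
    -- times the square of this number.
    im : ℕ → ℕ
    im n = 4 * halfTrace n * (y * ρ (suc n))

    period-disc : ∀ n → HasDisc (word (period s n)) (δ * (im n * im n))
    period-disc n = subst (λ M → HasDisc M (δ * (im n * im n))) (sym (word-period n))
      (unimodular⇒HasDisc (product (t n) (ρ n)) (product-unimodular n)
        (square (m₁₁ M + m₂₂ M) (halfTrace n) (trace-product n) halfTrace²))
      where
      open ≡-Reasoning
      M : Matrix
      M = product (t n) (ρ n)
      expand : ∀ s → 36 * s * s + 84 * s + 48 + 1 ≡ (6 * s + 7) * (6 * s + 7)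
      expand = ℕ-Solver.solve-∀
      halfTrace² : halfTrace n * halfTrace n ≡ δ * (y * y) * (ρ (suc n) * ρ (suc n)) + 1
      halfTrace² = trans (halfTrace-norm n) (cong (λ x → x * (ρ (suc n) * ρ (suc n)) + 1)
        (ℕ.+-cancelʳ-≡ 1 _ _ (trans (expand s) pell)))
      complete : ∀ τ → τ * τ + 4 * (τ + 2) ≡ (τ + 2) * (τ + 2) + 4
      complete = ℕ-Solver.solve-∀
      regroup : ∀ T δ y W → 4 * (T * T) * (4 * (δ * (y * y) * (W * W) + 1)) + 4 ≡
        δ * (4 * T * (y * W) * (4 * T * (y * W))) + 4 + 4 * (4 * (T * T))
      regroup = ℕ-Solver.solve-∀
      -- Here τ is the trace, and τ² = (τ + 2)² - 4 (τ + 2) + 4 with the negative term moved across.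
      square : ∀ τ T → τ + 2 ≡ 4 * (T * T) → T * T ≡ δ * (y * y) * (ρ (suc n) * ρ (suc n)) + 1 →
        τ * τ ≡ δ * (4 * T * (y * ρ (suc n)) * (4 * T * (y * ρ (suc n)))) + 4
      square τ T τ+2≡ T²≡ = ℕ.+-cancelʳ-≡ (4 * (4 * (T * T))) _ _ (begin
        τ * τ + 4 * (4 * (T * T))
          ≡⟨ cong (λ x → τ * τ + 4 * x) τ+2≡ ⟨
        τ * τ + 4 * (τ + 2)
          ≡⟨ complete τ ⟩
        (τ + 2) * (τ + 2) + 4
          ≡⟨ cong (λ x → x * x + 4) τ+2≡ ⟩
        4 * (T * T) * (4 * (T * T)) + 4
          ≡⟨ cong (λ x → 4 * (T * T) * (4 * x) + 4) T²≡ ⟩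
        4 * (T * T) * (4 * (δ * (y * y) * (ρ (suc n) * ρ (suc n)) + 1)) + 4
          ≡⟨ regroup T δ y (ρ (suc n)) ⟩
        δ * (4 * T * (y * ρ (suc n)) * (4 * T * (y * ρ (suc n)))) + 4 + 4 * (4 * (T * T)) ∎)

    overline-period∈ℚ[√] : 1 ≤ s → 1 ≤ y → ∀ n → [overline period s n ]∈ℚ[√ δ ]
    overline-period∈ℚ[√] 1≤s 1≤y n = overline∈ℚ[√] (im n) 2 1 _ (period-positive 1≤s n)
      (ℕ.>⇒≢ (ℕ.*-mono-≤ (ℕ.*-mono-≤ {1} {4} (s≤s z≤n) (1≤halfTrace n)) (ℕ.*-mono-≤ 1≤y (1≤ρ n))))
      (period-disc n)

-- Solutions of Pell's equation in the required residue class

2∣n[n+1] : ∀ n → ∃[ k ] n * suc n ≡ 2 * k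
2∣n[n+1] zero    = 0 , refl
2∣n[n+1] (suc n) with k , eq ← 2∣n[n+1] n = k + suc n , (begin
  suc n * suc (suc n)    ≡⟨ expand n ⟩
  n * suc n + 2 * suc n  ≡⟨ cong (_+ 2 * suc n) eq ⟩
  2 * k + 2 * suc n      ≡⟨ ℕ.*-distribˡ-+ 2 k (suc n) ⟨
  2 * (k + suc n)        ∎)
  where
  open ≡-Reasoning
  expand : ∀ n → suc n * suc (suc n) ≡ n * suc n + 2 * suc n
  expand = ℕ-Solver.solve-∀

-- Used with n + 1 = x, where the product is x (x² - 1). The induction adds 3 (n + 1) (n + 2), a
-- multiple of 6.
6∣n[n+1][n+2] : ∀ n → ∃[ m ] n * suc n * suc (suc n) ≡ 6 * m
6∣n[n+1][n+2] zero    = 0 , refl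
6∣n[n+1][n+2] (suc n) with m , eq ← 6∣n[n+1][n+2] n | k , eq′ ← 2∣n[n+1] (suc n) = m + k , (begin
  suc n * suc (suc n) * suc (suc (suc n))              ≡⟨ expand n ⟩
  n * suc n * suc (suc n) + 3 * (suc n * suc (suc n))  ≡⟨ cong₂ (λ x y → x + 3 * y) eq eq′ ⟩
  6 * m + 3 * (2 * k)                                  ≡⟨ collect m k ⟩
  6 * (m + k)                                          ∎)
  where
  open ≡-Reasoning
  expand : ∀ n → suc n * suc (suc n) * suc (suc (suc n)) ≡ n * suc n * suc (suc n) + 3 * (suc n * suc (suc n))
  expand = ℕ-Solver.solve-∀
  collect : ∀ m k → 6 * m + 3 * (2 * k) ≡ 6 * (m + k)
  collect = ℕ-Solver.solve-∀

-- The fourth power of the solution: its x-coordinate is 1 + 8 x² (x² - 1) ≡ 1 modulo 48.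
pell⇒pell-6s+7 : ∀ {δ} x y → 1 ≤ δ → 1 ≤ y → x * x ≡ δ * (y * y) + 1 →
  ∃[ s ] ∃[ y′ ] (1 ≤ s × 1 ≤ y′ × (6 * s + 7) * (6 * s + 7) ≡ δ * (y′ * y′) + 1)
pell⇒pell-6s+7 {δ} zero y 1≤δ 1≤y eq =
  contradiction (trans eq (ℕ.+-comm (δ * (y * y)) 1)) ℕ.0≢1+n
pell⇒pell-6s+7 {δ} (suc w) y 1≤δ 1≤y eq with 6∣n[n+1][n+2] w
-- The product is x (x² - 1) = x δ y², which is positive.
... | zero , w≡ = contradiction (begin
  δ * (y * y) * suc w      ≡⟨ cong (_* suc w) z≡ ⟨
  w * suc (suc w) * suc w  ≡⟨ swap w ⟩
  w * suc w * suc (suc w)  ≡⟨ w≡ ⟩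
  0                        ∎) (ℕ.>⇒≢ (ℕ.*-mono-≤ (ℕ.*-mono-≤ 1≤δ (ℕ.*-mono-≤ 1≤y 1≤y)) (s≤s (z≤n {w}))))
  where
  open ≡-Reasoning
  expand : ∀ w → w * suc (suc w) + 1 ≡ suc w * suc w
  expand = ℕ-Solver.solve-∀
  z≡ : w * suc (suc w) ≡ δ * (y * y)
  z≡ = ℕ.+-cancelʳ-≡ 1 _ _ (trans (expand w) eq)
  swap : ∀ w → w * suc (suc w) * suc w ≡ w * suc w * suc (suc w)
  swap = ℕ-Solver.solve-∀
-- With z = x² - 1 the new x-coordinate is 1 + 8 (z + 1) z = 1 + 48 (m + 1) (w + 1) = 1 + 48 (k +
-- 1), which is 6 s + 7 for s = 8 k + 7. The new y-coordinate is 4 x y (2 x² - 1), where 2 x² - 1 =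
-- 2 z + 1.
... | suc m , w≡ = 8 * k + 7 , 4 * (suc w * y) * (2 * z + 1) ,
  ℕ.≤-trans (s≤s z≤n) (ℕ.m≤n+m 7 (8 * k)) ,
  ℕ.*-mono-≤ (ℕ.*-mono-≤ {1} {4} (s≤s z≤n) (ℕ.*-mono-≤ (s≤s (z≤n {w})) 1≤y)) (ℕ.m≤n+m 1 (2 * z)) ,
  (begin
    (6 * (8 * k + 7) + 7) * (6 * (8 * k + 7) + 7)
      ≡⟨ cong (λ x → x * x) x≡ ⟩
    (8 * ((z + 1) * z) + 1) * (8 * ((z + 1) * z) + 1)
      ≡⟨ double-twice z ⟩
    16 * ((z + 1) * z) * ((2 * z + 1) * (2 * z + 1)) + 1
      ≡⟨ cong₂ (λ a b → 16 * (a * b) * ((2 * z + 1) * (2 * z + 1)) + 1)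
           (trans (cong (_+ 1) z≡) (sym eq)) z≡ ⟩
    16 * (suc w * suc w * (δ * (y * y))) * ((2 * z + 1) * (2 * z + 1)) + 1
      ≡⟨ regroup (suc w) δ y (2 * z + 1) ⟩
    δ * (4 * (suc w * y) * (2 * z + 1) * (4 * (suc w * y) * (2 * z + 1))) + 1 ∎)
  where
  open ≡-Reasoning
  z k : ℕ
  z = w * suc (suc w)
  k = m + w * suc m
  expand : ∀ w → w * suc (suc w) + 1 ≡ suc w * suc w
  expand = ℕ-Solver.solve-∀
  z≡ : z ≡ δ * (y * y)
  z≡ = ℕ.+-cancelʳ-≡ 1 _ _ (trans (expand w) eq)
  linear : ∀ m w → 6 * (8 * (m + w * suc m) + 7) + 7 ≡ 8 * (6 * suc m * suc w) + 1
  linear = ℕ-Solver.solve-∀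
  factor : ∀ w → w * suc w * suc (suc w) * suc w ≡ (w * suc (suc w) + 1) * (w * suc (suc w))
  factor = ℕ-Solver.solve-∀
  x≡ : 6 * (8 * k + 7) + 7 ≡ 8 * ((z + 1) * z) + 1
  x≡ = trans (linear m w)
    (cong (λ x → 8 * x + 1) (trans (cong (_* suc w) (sym w≡)) (factor w)))
  double-twice : ∀ z → (8 * ((z + 1) * z) + 1) * (8 * ((z + 1) * z) + 1) ≡
    16 * ((z + 1) * z) * ((2 * z + 1) * (2 * z + 1)) + 1
  double-twice = ℕ-Solver.solve-∀
  regroup : ∀ x δ y a → 16 * (x * x * (δ * (y * y))) * (a * a) + 1 ≡ δ * (4 * (x * y) * a * (4 * (x * y) * a)) + 1
  regroup = ℕ-Solver.solve-∀

proposition7p4 : (δ : ℕ) → 1 ≤ δ → ¬ (∃[ k ] δ ≡ k * k) →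
    ∃[ s ] (1 ≤ s × ((n : ℕ) → [overline period s n ]∈ℚ[√ δ ]))
proposition7p4 (suc d) 1≤δ nonsquare =
  let x , y , 1≤y , pell = pell-solvable d nonsquare
      s , y′ , 1≤s , 1≤y′ , pell′ = pell⇒pell-6s+7 x y 1≤δ 1≤y pell
  in s , 1≤s , Pattern.overline-period∈ℚ[√] s pell′ 1≤s 1≤y′
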